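{- Let $X,Y$ be valid sets. Let $W\mapsto Z$ be such that there exists a reaction rule $(L,R,\eta)$ that can be applied to $[\![X]\!]^\star$ and $W\mapsto Z$ is the modelled reaction rule (the multi-set rewrite rule corresponding to) $(L,R,\eta)$. Then the square formed by the interpretation $[\![\cdot]\!]^\star$ and the two rewritings commutes: if $X$ is rewritten into $Y$ by $W\mapsto Z$ (i.e. $X=W\uplus\Delta$ and $Y=Z\uplus\Delta$ for some multi-set $\Delta$), then $[\![X]\!]^\star$ is rewritten into $[\![Y]\!]^\star$ by $(L,R,\eta)$.
   Context: **Bigraphs.** A signature is $\Sigma=(K,arity)$ with $K$ a set of controls and $arity:K\to\mathbb N$. A bigraph under $\Sigma$ is $B=(V_B,E_B,P_B,ctrl_B,prnt_B,link_B):\langle m,X\rangle\to\langle n,Y\rangle$, where $m,n$ are finite ordinals (the sites, resp. roots), $X,Y,V_B,E_B$ are finite sets (inner names, outer names, nodes, edges), $ctrl_B:V_B\to K$, $P_B=\{(v,i)\mid v\in V_B,\ i\in arity(ctrl_B\,v)\}$ (ports), $prnt_B:V_B\cup m\to V_B\cup n$ is total and establishes a tree-shaped (acyclic) parent ordering on the nodes, and $link_B:X\cup P_B\to E_B\cup Y$ is total. The sets $m,n,X,Y,V_B,E_B$ are assumed disjoint. $\langle m,X\rangle$ and $\langle n,Y\rangle$ are the inner and outer interfaces; $\epsilon=\langle 0,\emptyset\rangle$. A bigraph is ground if its inner interface is $\epsilon$; a ground bigraph is also called an agent. **Composition.** For $F:\langle k,X\rangle\to\langle m,Y\rangle$ and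 $G:\langle m,Y\rangle\to\langle n,Z\rangle$ with disjoint nodes and edges, $G\circ F:\langle k,X\rangle\to\langle n,Z\rangle$ has $V=V_G\uplus V_F$, $E=E_G\uplus E_F$, $ctrl=ctrl_G\uplus ctrl_F$; $prnt\,x=prnt_F\,x$ if $x\in k\uplus V_F$ and $prnt_F\,x\in V_F$, $prnt\,x=prnt_G\,j$ if $x\in k\uplus V_F$ and $prnt_F\,x=j\in m$, $prnt\,x=prnt_G\,x$ if $x\in V_G$; $link\,x=link_F\,x$ if $x\in X\uplus P_F$ and $link_F\,x\in E_F$, $link\,x=link_G\,y$ if $x\in X\uplus P_F$ and $link_F\,x=y\in Y$, $link\,x=link_G\,x$ if $x\in P_G$. **Juxtaposition.** For $F:\langle k,X\rangle\to\langle m,Y\rangle$ and $G:\langle l,W\rangle\to\langle n,Z\rangle$ with disjoint nodes, edges and names, $G\otimes F:\langle k+l,X\uplus W\rangle\to\langle m+n,Y\uplus Z\rangle$ has as components the disjoint unions of those of $F$ and $G$, with the sites and roots of $G$ shifted by $k$ and $m$ respectively. $d\Vert d'$ is $d\otimes d'$ where $d,d'$ may share edges and outer names. **Lean equivalence.** $B\bumpeq G$, for bigraphs with the same interfaces $\langle k,X\rangle\to\langle m,Y\rangle$, if there are bijections $\rho_V:V_B\to V_G$, $\rho_E:E_B\to E_G$ with $ctrl_G\circ\rho_V=ctrl_B$, $prnt_G\circ(Id_k\uplus\rho_V)=(Id_m\uplus\rho_V)\circ prnt_B$, $link_G\circ(Id_X\uplus\rho_P)=(Id_Y\uplus\rho_E)\circ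 link_B$, where $\rho_P(v,i)=(\rho_V v,i)$. **Reaction rules.** A ground reaction rule is a pair $(L,R)$ of ground bigraphs $L,R:\epsilon\to J$ with the same interfaces; it is regarded as a triple with $\eta$ empty. It rewrites $B\equiv C\circ L$ into $B'\equiv C\circ R$. A parametric reaction rule is a triple $(L:\langle m,X\rangle\to J,\ R:\langle m',X\rangle\to J,\ \eta:m'\to m)$ with $\eta$ a total function and the link graph inner interfaces of $L,R$ empty ($X=\emptyset$). For $F\equiv G\circ(d_0\otimes\dots\otimes d_{m-1})$ with $G$ a link graph (no nodes, identity on places) and each $d_i$ without inner names and with exactly one root, the instantiation is $\overline\eta\,F=G\circ(d'_0\Vert\dots\Vert d'_{m'-1})$ with $d'_j\bumpeq d_{\eta\,j}$ for all $j\in m'$. A parametric rule rewrites $B\equiv C\circ(D\otimes L)\circ C'$ into $B'\equiv C\circ(D\otimes R)\circ(\overline\eta\,C')$. A rule can be applied to $B$ if $B$ has such a decomposition. Here $\equiv$ expresses decomposition of the bigraph (equality up to the choice of names for nodes and edges). **Relation symbols and encoding.** Facts are built from names of the disjoint sorts node, root, site, port, o_name, i_name, e_name, and from controls and natural numbers in unary (z, s $N$); $|t|$ denotes the element (e.g. the ordinal) that a name $t$ stands for. The facts are is_root $r$, is_node $a$, is_site $s$, is_port $p$, is_o_name $o$, is_i_name $i$, is_e_name $e$, prnt $x\,y$ ($x$ a node or site, $y$ a node or root), link $x\,y$ ($x$ an inner name or port, $y$ an outer name or edge), lc $a\,k$ (node, control), lp $p\,a$ (port, node), has_child_p $y\,N$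 ($y$ node or root), has_child_l $y\,N$ ($y$ edge or outer name), vp $a\,N$ ($a$ a node). Constructors injecting the sorts into sources and destinations are suppressed. Names are chosen injectively for the components of $B$; the same component has the same name in all encodings considered. $[\![B]\!]$ is the multi-set containing exactly once: is_root $r$, has_child_p $r$ $|prnt_B^{ -1}(r)|$ for each root $r$; is_node $v$, lc $v$ $(ctrl_B\,v)$, has_child_p $v$ $|prnt_B^{ -1}(v)|$, prnt $v$ $(prnt_B\,v)$ for each node $v$; is_site $s$, prnt $s$ $(prnt_B\,s)$ for each site $s$; is_port $p$, lp $p\,v$, link $p$ $(link_B\,p)$ for each port $p=(v,i)$; is_o_name $o$, has_child_l $o$ $|link_B^{ -1}(o)|$ for each outer name $o$; is_e_name $e$, has_child_l $e$ $|link_B^{ -1}(e)|$ for each edge $e$; is_i_name $x$, link $x$ $(link_B\,x)$ for each inner name $x$. **Validity.** Let $\mapsto$ be the rewriting generated by the following rules (arbitrary $\Delta$ may be added to both sides): {is_root $R$, has_child_p $R$ z} $\mapsto\emptyset$; {is_o_name $O$, has_child_l $O$ z} $\mapsto\emptyset$; {is_e_name $E$, has_child_l $E$ z} $\mapsto\emptyset$; {is_port $P$, lp $P\,A$, vp $A$ (s z), link $P\,D$, has_child_l $D$ (s $N$)} $\mapsto$ {has_child_l $D\,N$}; {is_i_name $I$, link $I\,D$, has_child_l $D$ (s $N$)} $\mapsto$ {has_child_l $D\,N$}; {is_site $S$, prnt $S\,D$, has_child_p $D$ (s $N$)} $\mapsto$ {has_child_p $D\,N$}; {is_node $A$, has_child_p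 $A$ z, prnt $A\,D$, has_child_p $D$ (s $N$), lc $A\,K$} $\mapsto$ {has_child_p $D\,N$} if $arity\,K=0$; {is_node $A$, has_child_p $A$ z, prnt $A\,D$, has_child_p $D$ (s $N$), lc $A\,K$} $\mapsto$ {has_child_p $D\,N$, vp $A\,N'$} if $arity\,K=N'>0$; {is_port $P$, lp $P\,A$, vp $A$ (s (s $N'$)), link $P\,D$, has_child_l $D$ (s $N$)} $\mapsto$ {vp $A$ (s $N'$), has_child_l $D\,N$}. A multi-set $S$ is valid iff it rewrites to $\emptyset$ (in the reflexive-transitive closure), every element of $S$ has multiplicity one, and each of has_child_p, has_child_l, vp is unique in its first argument in $S$. **Interpretation.** For a valid $S$, $[\![S]\!]^\star$ is the bigraph read off from $S$ (inverse to the encoding): its nodes, edges, ports, roots, sites, outer names and inner names are the (elements denoted by the) names $t$ with, respectively, is_node $t$, is_e_name $t$, is_port $t$, is_root $t$, is_site $t$, is_o_name $t$, is_i_name $t$ in $S$; ports $p$ with lp $p\,v\in S$ are the ports of $v$; and $ctrl\,v=k$ iff lc $v\,k\in S$, $prnt\,x=y$ iff prnt $x\,y\in S$, $link\,x=y$ iff link $x\,y\in S$. **Partition.** For a bigraph $C$, $[\![C]\!]$ is partitioned as $\widetilde C\uplus out_C\uplus in_C$, where $out_C$ contains only the references to roots (is_root), outer names (is_o_name), prnt facts on roots and link facts on outer names; $in_C$ contains only the references to sites (is_site), inner names (is_i_name), prnt facts on sites and link facts on inner names; and $\widetilde C=[\![C]\!]\setminus out_C\setminus in_C$. For a composite $C\circ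 C'$, $eq_{CC'}$ is $$\{\text{prnt }x\,y\mid \text{is\_root }r\in[\![C']\!],\ \text{is\_site }s\in[\![C]\!],\ |s|=|r|,\ \text{prnt }x\,r\in[\![C']\!],\ \text{prnt }s\,y\in[\![C]\!]\}$$ $$\cup\ \{\text{link }x\,y\mid \text{is\_i\_name }i\in[\![C]\!],\ \text{is\_o\_name }o\in[\![C']\!],\ |i|=|o|,\ \text{link }i\,y\in[\![C]\!],\ \text{link }x\,o\in[\![C']\!]\}.$$ **Modelled reaction rule $W\mapsto Z$.** For a ground rule $(L,R)$ and context $C$: $W=\widetilde L\cup eq_{CL}$, $Z=\widetilde R\cup eq_{CR}$. For a parametric rule and decomposition $C,D,C'$: $W=eq_{C((D\otimes L)\circ C')}\cup\widetilde L\cup\widetilde D\cup eq_{DC'}\cup eq_{LC'}\cup\widetilde{C'}$ and $Z=eq_{C((D\otimes R)\circ(\overline\eta C'))}\cup\widetilde R\cup\widetilde D\cup eq_{D(\overline\eta C')}\cup eq_{R(\overline\eta C')}\cup\widetilde{(\overline\eta C')}$. The decomposition is one of the bigraph to which the rule is applied.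
   Formalization: Added: the facts on sites of the parameters (in_C') agree before and after instantiation; otherwise the claim fails, e.g. when η swaps parameters with sites. Also out_C includes the has_child_p and has_child_l facts on roots and outer names. -}

module Defs where

open import Level using (0ℓ)
open import Data.Fin using (Fin; fromℕ; inject₁)
open import Data.List using (List; []; _∷_; _++_; map; filter; length; upTo; concatMap; deduplicate; fromMaybe)
open import Data.List.Membership.Propositional using (_∈_)
open import Data.List.Relation.Binary.BagAndSetEquality using (_∼[_]_; set)
open import Data.List.Relation.Binary.Disjoint.Propositional using (Disjoint)
open import Data.List.Relation.Binary.Permutation.Propositional using (_↭_)
open import Data.List.Relation.Unary.Unique.Propositional using (Unique)
open import Data.Maybe using (Maybe; just; nothing; maybe; _>>=_; _<∣>_)
import Data.Maybe as Maybe
import Data.Maybe.Properties as Maybe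
open import Data.Nat using (ℕ; zero; suc; _+_; _∸_; _<_; _<?_; _≟_)
open import Data.Product using (Σ-syntax; ∃; ∃-syntax; _×_; _,_; proj₁)
open import Data.Unit using (⊤)
open import Function using (id; _∘_)
open import Function.Bundles using (_⇔_)
open import Relation.Binary.Construct.Closure.ReflexiveTransitive using (Star)
open import Relation.Binary.Construct.Closure.Transitive using (TransClosure)
open import Relation.Binary.Core using (Rel)
open import Relation.Binary.Definitions using (DecidableEquality)
open import Relation.Binary.PropositionalEquality using (_≡_; _≢_; refl; cong)
open import Relation.Nullary using (¬_; yes; no)
open import Relation.Nullary.Decidable using (map′)
open import Relation.Unary using (Pred; _∪_; _≐_)

record Signature : Set₁ where
  field
    Control : Set
    arity   : Control → ℕ

-- Nodes, edges and link names are drawn from the infinite supply ℕ; roots and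
-- sites are ordinals.  Every component is its own name, so |t| is t; the sorts
-- are kept apart by the constructors below and by those of Fact, which also
-- makes the sets m, n, X, Y, V, E of a bigraph disjoint.
Node Edge LinkName Root Site Port : Set
Node     = ℕ
Edge     = ℕ
LinkName = ℕ
Root     = ℕ
Site     = ℕ
Port     = Node × ℕ

data PlaceSrc : Set where
  node : Node → PlaceSrc
  site : Site → PlaceSrc

data PlaceDst : Set where
  node : Node → PlaceDst
  root : Root → PlaceDst

data LinkSrc : Set where
  inner : LinkName → LinkSrc
  port  : Port → LinkSrc

data LinkDst : Set where
  outer : LinkName → LinkDst
  edge  : Edge → LinkDst

_≟ᴾ_ : DecidableEquality PlaceDst
node v ≟ᴾ node w = map′ (cong node) (λ { refl → refl }) (v ≟ w)
node _ ≟ᴾ root _ = no λ ()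
root _ ≟ᴾ node _ = no λ ()
root r ≟ᴾ root s = map′ (cong root) (λ { refl → refl }) (r ≟ s)

_≟ᴸ_ : DecidableEquality LinkDst
outer x ≟ᴸ outer y = map′ (cong outer) (λ { refl → refl }) (x ≟ y)
outer _ ≟ᴸ edge _  = no λ ()
edge _  ≟ᴸ outer _ = no λ ()
edge d  ≟ᴸ edge e  = map′ (cong edge) (λ { refl → refl }) (d ≟ e)

-- Finite sets are lists compared up to having the same elements.
infix 4 _≈ᴵ_

record Interface : Set where
  constructor ⟨_,_⟩
  field
    width : ℕ
    names : List LinkName

open Interface public

ε : Interface
ε = ⟨ 0 , [] ⟩

_≈ᴵ_ : Rel Interface 0ℓ
I ≈ᴵ J = width I ≡ width J × names I ∼[ set ] names J

record BijectionOn (f : ℕ → ℕ) (xs ys : List ℕ) : Set where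
  field
    maps-to    : ∀ {x} → x ∈ xs → f x ∈ ys
    injective  : ∀ {x x′} → x ∈ xs → x′ ∈ xs → f x ≡ f x′ → x ≡ x′
    surjective : ∀ {y} → y ∈ ys → ∃[ x ] x ∈ xs × f x ≡ y

module Bigraphs (𝒮 : Signature) where
  open Signature 𝒮

  -- The components of a bigraph, before the conditions of IsBigraph.  Functions
  -- on finite sets of components are partial functions on all names.
  record PreBigraph : Set where
    field
      sites roots           : ℕ
      innerNames outerNames : List LinkName
      nodes                 : List Node
      edges                 : List Edge
      ctrl                  : Node → Maybe Control
      parent                : PlaceSrc → Maybe PlaceDst
      linkTo                : LinkSrc → Maybe LinkDst

    innerface outerface : Interface
    innerface = ⟨ sites , innerNames ⟩
    outerface = ⟨ roots , outerNames ⟩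

    IsPort : Pred Port 0ℓ
    IsPort (v , i) = ∃[ k ] ctrl v ≡ just k × i < arity k

    IsPlaceSrc : Pred PlaceSrc 0ℓ
    IsPlaceSrc (node v) = v ∈ nodes
    IsPlaceSrc (site s) = s < sites

    IsPlaceDst : Pred PlaceDst 0ℓ
    IsPlaceDst (node v) = v ∈ nodes
    IsPlaceDst (root r) = r < roots

    IsLinkSrc : Pred LinkSrc 0ℓ
    IsLinkSrc (inner x) = x ∈ innerNames
    IsLinkSrc (port p)  = IsPort p

    IsLinkDst : Pred LinkDst 0ℓ
    IsLinkDst (outer y) = y ∈ outerNames
    IsLinkDst (edge e)  = e ∈ edges

    ChildOf : Rel Node 0ℓ
    ChildOf v w = parent (node v) ≡ just (node w)

    ports : List Port
    ports = concatMap (λ v → maybe (λ k → map (v ,_) (upTo (arity k))) [] (ctrl v)) nodes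

    placeSrcs : List PlaceSrc
    placeSrcs = map node nodes ++ map site (upTo sites)

    linkSrcs : List LinkSrc
    linkSrcs = map inner innerNames ++ map port ports

    #children : PlaceDst → ℕ
    #children y = length (filter (λ x → Maybe.≡-dec _≟ᴾ_ (parent x) (just y)) placeSrcs)

    #points : LinkDst → ℕ
    #points y = length (filter (λ x → Maybe.≡-dec _≟ᴸ_ (linkTo x) (just y)) linkSrcs)

  open PreBigraph public

  record IsBigraph (B : PreBigraph) : Set where
    field
      innerNames-unique : Unique (innerNames B)
      outerNames-unique : Unique (outerNames B)
      nodes-unique      : Unique (nodes B)
      edges-unique      : Unique (edges B)
      ctrl-domain       : ∀ v → v ∈ nodes B ⇔ (∃[ k ] ctrl B v ≡ just k)
      parent-domain     : ∀ x → IsPlaceSrc B x ⇔ (∃[ y ] parent B x ≡ just y)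
      parent-codomain   : ∀ {x y} → parent B x ≡ just y → IsPlaceDst B y
      parent-acyclic    : ∀ v → ¬ TransClosure (ChildOf B) v v
      linkTo-domain     : ∀ x → IsLinkSrc B x ⇔ (∃[ y ] linkTo B x ≡ just y)
      linkTo-codomain   : ∀ {x y} → linkTo B x ≡ just y → IsLinkDst B y

  record Bigraph : Set where
    constructor _,_
    field
      pre       : PreBigraph
      isBigraph : IsBigraph pre

  open Bigraph public

  Ground : Pred PreBigraph 0ℓ
  Ground B = innerface B ≈ᴵ ε

  infixr 9 _⊙_
  infixr 10 _⊗_

  composeParent : (g f : PlaceSrc → Maybe PlaceDst) → PlaceSrc → Maybe PlaceDst
  composeParent g f = λ where
      (site s) → f (site s) >>= through
      (node v) → maybe through (g (node v)) (f (node v))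
    where
    through : PlaceDst → Maybe PlaceDst
    through (node w) = just (node w)
    through (root j) = g (site j)

  composeLink : (g f : LinkSrc → Maybe LinkDst) → LinkSrc → Maybe LinkDst
  composeLink g f = λ where
      (inner x) → f (inner x) >>= through
      (port p)  → maybe through (g (port p)) (f (port p))
    where
    through : LinkDst → Maybe LinkDst
    through (edge e)  = just (edge e)
    through (outer y) = g (inner y)

  -- Composition; meaningful under Composable.
  _⊙_ : PreBigraph → PreBigraph → PreBigraph
  G ⊙ F = record
    { sites      = sites F
    ; roots      = roots G
    ; innerNames = innerNames F
    ; outerNames = outerNames G
    ; nodes      = nodes G ++ nodes F
    ; edges      = edges G ++ edges F
    ; ctrl       = λ v → ctrl F v <∣> ctrl G v
    ; parent     = composeParent (parent G) (parent F)
    ; linkTo     = composeLink (linkTo G) (linkTo F)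
    }

  record Composable (G F : PreBigraph) : Set where
    field
      interface      : outerface F ≈ᴵ innerface G
      nodes-disjoint : Disjoint (nodes G) (nodes F)
      edges-disjoint : Disjoint (edges G) (edges F)

  shiftRoot : ℕ → PlaceDst → PlaceDst
  shiftRoot m (node v) = node v
  shiftRoot m (root r) = root (m + r)

  juxtaposeParent : (F G : PreBigraph) → PlaceSrc → Maybe PlaceDst
  juxtaposeParent F G (node v) =
    parent F (node v) <∣> Maybe.map (shiftRoot (roots F)) (parent G (node v))
  juxtaposeParent F G (site s) with s <? sites F
  ... | yes _ = parent F (site s)
  ... | no  _ = Maybe.map (shiftRoot (roots F)) (parent G (site (s ∸ sites F)))

  -- In G ⊗ F it is the left operand G whose sites and roots are shifted.  The
  -- same operation serves for G ⊗ F (under Tensorable) and G ∥ F (under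
  -- Parallel); duplicates arise, and are removed, only in the latter case.
  _⊗_ : PreBigraph → PreBigraph → PreBigraph
  G ⊗ F = record
    { sites      = sites F + sites G
    ; roots      = roots F + roots G
    ; innerNames = innerNames F ++ innerNames G
    ; outerNames = deduplicate _≟_ (outerNames F ++ outerNames G)
    ; nodes      = nodes F ++ nodes G
    ; edges      = deduplicate _≟_ (edges F ++ edges G)
    ; ctrl       = λ v → ctrl F v <∣> ctrl G v
    ; parent     = juxtaposeParent F G
    ; linkTo     = λ x → linkTo F x <∣> linkTo G x
    }

  record Parallel (G F : PreBigraph) : Set where
    field
      nodes-disjoint      : Disjoint (nodes G) (nodes F)
      innerNames-disjoint : Disjoint (innerNames G) (innerNames F)

  record Tensorable (G F : PreBigraph) : Set where
    field
      parallel            : Parallel G F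
      edges-disjoint      : Disjoint (edges G) (edges F)
      outerNames-disjoint : Disjoint (outerNames G) (outerNames F)

  empty : PreBigraph
  empty = record
    { sites = 0 ; roots = 0 ; innerNames = [] ; outerNames = [] ; nodes = [] ; edges = []
    ; ctrl = λ _ → nothing ; parent = λ _ → nothing ; linkTo = λ _ → nothing }

  -- d₀, …, dₙ₋₁ side by side in this order: if every dᵢ has one root, the root
  -- of dᵢ is root i of the result.
  ⨂ : ∀ {n} → (Fin n → PreBigraph) → PreBigraph
  ⨂ {zero}  d = empty
  ⨂ {suc n} d = d (fromℕ n) ⊗ ⨂ (d ∘ inject₁)

  renamePlaceSrc : (Node → Node) → PlaceSrc → PlaceSrc
  renamePlaceSrc ρ (node v) = node (ρ v)
  renamePlaceSrc ρ (site s) = site s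

  renamePlaceDst : (Node → Node) → PlaceDst → PlaceDst
  renamePlaceDst ρ (node v) = node (ρ v)
  renamePlaceDst ρ (root r) = root r

  renameLinkSrc : (Node → Node) → LinkSrc → LinkSrc
  renameLinkSrc ρ (inner x)      = inner x
  renameLinkSrc ρ (port (v , i)) = port (ρ v , i)

  renameLinkDst : (Edge → Edge) → LinkDst → LinkDst
  renameLinkDst ρ (outer y) = outer y
  renameLinkDst ρ (edge e)  = edge (ρ e)

  record LeanEquivalence (ρⱽ : Node → Node) (ρᴱ : Edge → Edge) (B G : PreBigraph) : Set where
    field
      same-innerface : innerface B ≈ᴵ innerface G
      same-outerface : outerface B ≈ᴵ outerface G
      nodes-bijection : BijectionOn ρⱽ (nodes B) (nodes G)
      edges-bijection : BijectionOn ρᴱ (edges B) (edges G)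
      ctrl-commutes   : ∀ {v} → v ∈ nodes B → ctrl G (ρⱽ v) ≡ ctrl B v
      parent-commutes : ∀ {x} → IsPlaceSrc B x →
        parent G (renamePlaceSrc ρⱽ x) ≡ Maybe.map (renamePlaceDst ρⱽ) (parent B x)
      linkTo-commutes : ∀ {x} → IsLinkSrc B x →
        linkTo G (renameLinkSrc ρⱽ x) ≡ Maybe.map (renameLinkDst ρᴱ) (linkTo B x)

  infix 4 _≏_ _≡ᴮ_

  _≏_ : Rel PreBigraph 0ℓ
  B ≏ G = ∃[ ρⱽ ] ∃[ ρᴱ ] LeanEquivalence ρⱽ ρᴱ B G

  -- Equality, names of nodes and edges included.
  _≡ᴮ_ : Rel PreBigraph 0ℓ
  _≡ᴮ_ = LeanEquivalence id id

  record IsLinkGraph (m : ℕ) (G : PreBigraph) : Set where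
    field
      no-nodes  : nodes G ≡ []
      sites≡m   : sites G ≡ m
      roots≡m   : roots G ≡ m
      id-places : ∀ {s} → s < m → parent G (site s) ≡ just (root s)

  -- The link graph of G, with the identity on n places.
  _at_ : PreBigraph → ℕ → PreBigraph
  G at n = record G { sites = n ; roots = n ; parent = idPlaces }
    where
    idPlaces : PlaceSrc → Maybe PlaceDst
    idPlaces (node _) = nothing
    idPlaces (site s) with s <? n
    ... | yes _ = just (root s)
    ... | no  _ = nothing

  -- F′ is (a choice of names for) the instantiation of F along η.  The outer
  -- names of a parameter dᵢ with i outside the image of η do not occur in
  -- d′₀ ∥ … ∥ d′ₘ′₋₁; G then has these among its inner names, but nothing is
  -- linked to them.
  record Instantiation {m m′ : ℕ} (η : Fin m′ → Fin m) (F F′ : PreBigraph) : Set where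
    field
      G                : Bigraph
      d                : Fin m → Bigraph
      d′               : Fin m′ → Bigraph
      G-linkGraph      : IsLinkGraph m (pre G)
      d-no-innerNames  : ∀ i → innerNames (pre (d i)) ≡ []
      d-one-root       : ∀ i → roots (pre (d i)) ≡ 1
      d-tensorable     : ∀ i j → i ≢ j → Tensorable (pre (d i)) (pre (d j))
      d-composable     : Composable (pre G) (⨂ (pre ∘ d))
      decomposition    : F ≏ pre G ⊙ ⨂ (pre ∘ d)
      d′-copies        : ∀ j → pre (d′ j) ≏ pre (d (η j))
      d′-parallel      : ∀ i j → i ≢ j → Parallel (pre (d′ i)) (pre (d′ j))
      d′-edges         : Disjoint (edges (pre G)) (edges (⨂ (pre ∘ d′)))
      instantiation    : F′ ≏ (pre G at m′) ⊙ ⨂ (pre ∘ d′)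

  record GroundRule : Set where
    field
      L R            : Bigraph
      L-ground       : Ground (pre L)
      R-ground       : Ground (pre R)
      same-outerface : outerface (pre L) ≈ᴵ outerface (pre R)

  record ParametricRule : Set where
    field
      m m′           : ℕ
      L R            : Bigraph
      L-innerface    : innerface (pre L) ≈ᴵ ⟨ m , [] ⟩
      R-innerface    : innerface (pre R) ≈ᴵ ⟨ m′ , [] ⟩
      same-outerface : outerface (pre L) ≈ᴵ outerface (pre R)
      η              : Fin m′ → Fin m

  data ReactionRule : Set where
    ground     : GroundRule → ReactionRule
    parametric : ParametricRule → ReactionRule

  -- Contexts in which a rule reacts.  A rule is given up to the choice of names,
  -- so that L₁ and R₁ are variants of its redex and reactum L and R.
  record GroundReaction (r : GroundRule) : Set where
    open GroundRule r
    field
      L₁ R₁        : Bigraph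
      L₁≏L         : pre L₁ ≏ pre L
      R₁≏R         : pre R₁ ≏ pre R
      C            : Bigraph
      C-L₁         : Composable (pre C) (pre L₁)
      C-R₁         : Composable (pre C) (pre R₁)

  record ParametricReaction (r : ParametricRule) : Set where
    open ParametricRule r
    field
      L₁ R₁        : Bigraph
      L₁≏L         : pre L₁ ≏ pre L
      R₁≏R         : pre R₁ ≏ pre R
      C D C′ ηC′   : Bigraph
      D-L₁         : Tensorable (pre D) (pre L₁)
      DL₁-C′       : Composable (pre D ⊗ pre L₁) (pre C′)
      C-DL₁C′      : Composable (pre C) ((pre D ⊗ pre L₁) ⊙ pre C′)
      ηC′-inst     : Instantiation η (pre C′) (pre ηC′)
      D-R₁         : Tensorable (pre D) (pre R₁)
      DR₁-ηC′      : Composable (pre D ⊗ pre R₁) (pre ηC′)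
      C-DR₁ηC′     : Composable (pre C) ((pre D ⊗ pre R₁) ⊙ pre ηC′)

  Reaction : ReactionRule → Set
  Reaction (ground r)     = GroundReaction r
  Reaction (parametric r) = ParametricReaction r

  before after : (r : ReactionRule) → Reaction r → PreBigraph
  before (ground _) ρ = pre C ⊙ pre L₁
    where open GroundReaction ρ
  before (parametric _) ρ = pre C ⊙ (pre D ⊗ pre L₁) ⊙ pre C′
    where open ParametricReaction ρ
  after (ground _) ρ = pre C ⊙ pre R₁
    where open GroundReaction ρ
  after (parametric _) ρ = pre C ⊙ (pre D ⊗ pre R₁) ⊙ pre ηC′
    where open ParametricReaction ρ

  Applicable : ReactionRule → Pred Bigraph 0ℓ
  Applicable r B = Σ[ ρ ∈ Reaction r ] pre B ≏ before r ρ

  _⟶[_]_ : Bigraph → ReactionRule → Bigraph → Set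
  B ⟶[ r ] B′ = Σ[ ρ ∈ Reaction r ] pre B ≏ before r ρ × pre B′ ≏ after r ρ

  data Fact : Set where
    is-root     : Root → Fact
    is-node     : Node → Fact
    is-site     : Site → Fact
    is-port     : Port → Fact
    is-o-name   : LinkName → Fact
    is-i-name   : LinkName → Fact
    is-e-name   : Edge → Fact
    prnt        : PlaceSrc → PlaceDst → Fact
    link        : LinkSrc → LinkDst → Fact
    lc          : Node → Control → Fact
    lp          : Port → Node → Fact
    has-child-p : PlaceDst → ℕ → Fact
    has-child-l : LinkDst → ℕ → Fact
    vp          : Node → ℕ → Fact

  -- Multi-sets are lists up to permutation.
  Multiset : Set
  Multiset = List Fact

  ⟦_⟧ : PreBigraph → Multiset
  ⟦ B ⟧ =
       concatMap (λ r → is-root r ∷ has-child-p (root r) (#children B (root r)) ∷ []) (upTo (roots B))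
    ++ concatMap (λ v → is-node v ∷ has-child-p (node v) (#children B (node v))
                        ∷ fromMaybe (Maybe.map (lc v) (ctrl B v)) ++ parentFact (node v)) (nodes B)
    ++ concatMap (λ s → is-site s ∷ parentFact (site s)) (upTo (sites B))
    ++ concatMap (λ p → is-port p ∷ lp p (proj₁ p) ∷ linkFact (port p)) (ports B)
    ++ concatMap (λ o → is-o-name o ∷ has-child-l (outer o) (#points B (outer o)) ∷ []) (outerNames B)
    ++ concatMap (λ e → is-e-name e ∷ has-child-l (edge e) (#points B (edge e)) ∷ []) (edges B)
    ++ concatMap (λ x → is-i-name x ∷ linkFact (inner x)) (innerNames B)
    where
    parentFact : PlaceSrc → List Fact
    parentFact x = fromMaybe (Maybe.map (prnt x) (parent B x))

    linkFact : LinkSrc → List Fact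
    linkFact x = fromMaybe (Maybe.map (link x) (linkTo B x))

  record Rewrites (W Z S T : Multiset) : Set where
    field
      Δ     : Multiset
      S≡W⊎Δ : S ↭ W ++ Δ
      T≡Z⊎Δ : T ↭ Z ++ Δ

  data ValidityRule : Multiset → Multiset → Set where
    root₀ : ∀ {r} → ValidityRule (is-root r ∷ has-child-p (root r) 0 ∷ []) []
    outer₀ : ∀ {o} → ValidityRule (is-o-name o ∷ has-child-l (outer o) 0 ∷ []) []
    edge₀ : ∀ {e} → ValidityRule (is-e-name e ∷ has-child-l (edge e) 0 ∷ []) []
    port₁ : ∀ {p a y n} → ValidityRule
      (is-port p ∷ lp p a ∷ vp a 1 ∷ link (port p) y ∷ has-child-l y (suc n) ∷ [])
      (has-child-l y n ∷ [])
    innerName : ∀ {i y n} → ValidityRule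
      (is-i-name i ∷ link (inner i) y ∷ has-child-l y (suc n) ∷ [])
      (has-child-l y n ∷ [])
    site₁ : ∀ {s y n} → ValidityRule
      (is-site s ∷ prnt (site s) y ∷ has-child-p y (suc n) ∷ [])
      (has-child-p y n ∷ [])
    node₀ : ∀ {a y n k} → arity k ≡ 0 → ValidityRule
      (is-node a ∷ has-child-p (node a) 0 ∷ prnt (node a) y ∷ has-child-p y (suc n) ∷ lc a k ∷ [])
      (has-child-p y n ∷ [])
    node₊ : ∀ {a y n k n′} → arity k ≡ n′ → 0 < n′ → ValidityRule
      (is-node a ∷ has-child-p (node a) 0 ∷ prnt (node a) y ∷ has-child-p y (suc n) ∷ lc a k ∷ [])
      (has-child-p y n ∷ vp a n′ ∷ [])
    port₊ : ∀ {p a y n n′} → ValidityRule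
      (is-port p ∷ lp p a ∷ vp a (suc (suc n′)) ∷ link (port p) y ∷ has-child-l y (suc n) ∷ [])
      (vp a (suc n′) ∷ has-child-l y n ∷ [])

  _↦_ : Rel Multiset 0ℓ
  S ↦ T = ∃[ W ] ∃[ Z ] ValidityRule W Z × Rewrites W Z S T

  record Valid (S : Multiset) : Set where
    field
      reduces            : Star _↦_ S []
      multiplicity-one   : Unique S
      has-child-p-unique : ∀ {y m n} → has-child-p y m ∈ S → has-child-p y n ∈ S → m ≡ n
      has-child-l-unique : ∀ {y m n} → has-child-l y m ∈ S → has-child-l y n ∈ S → m ≡ n
      vp-unique          : ∀ {a m n} → vp a m ∈ S → vp a n ∈ S → m ≡ n

  -- B is the bigraph ⟦ S ⟧⋆ read off from S.  This determines B up to _≡ᴮ_.  It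
  -- is a relation, because for some valid S the components read off do not form
  -- a bigraph (e.g. the only root may be root 7).
  record _⟦⟧⋆_ (S : Multiset) (B : Bigraph) : Set where
    field
      nodes⋆  : ∀ v → v ∈ nodes (pre B) ⇔ is-node v ∈ S
      edges⋆  : ∀ e → e ∈ edges (pre B) ⇔ is-e-name e ∈ S
      ports⋆  : ∀ p → IsPort (pre B) p ⇔ is-port p ∈ S
      roots⋆  : ∀ r → r < roots (pre B) ⇔ is-root r ∈ S
      sites⋆  : ∀ s → s < sites (pre B) ⇔ is-site s ∈ S
      outer⋆  : ∀ o → o ∈ outerNames (pre B) ⇔ is-o-name o ∈ S
      inner⋆  : ∀ i → i ∈ innerNames (pre B) ⇔ is-i-name i ∈ S
      lp⋆     : ∀ p v → (IsPort (pre B) p × proj₁ p ≡ v) ⇔ lp p v ∈ S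
      ctrl⋆   : ∀ v k → ctrl (pre B) v ≡ just k ⇔ lc v k ∈ S
      parent⋆ : ∀ x y → parent (pre B) x ≡ just y ⇔ prnt x y ∈ S
      link⋆   : ∀ x y → linkTo (pre B) x ≡ just y ⇔ link x y ∈ S

  -- The counts has-child-p and has-child-l of roots and outer names belong to
  -- the interface as well: a root or outer name of C′ is no component of C ∘ C′.
  data OnOuterface : Pred Fact 0ℓ where
    is-root     : ∀ {r} → OnOuterface (is-root r)
    is-o-name   : ∀ {o} → OnOuterface (is-o-name o)
    prnt        : ∀ {x r} → OnOuterface (prnt x (root r))
    link        : ∀ {x o} → OnOuterface (link x (outer o))
    has-child-p : ∀ {r n} → OnOuterface (has-child-p (root r) n)
    has-child-l : ∀ {o n} → OnOuterface (has-child-l (outer o) n)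

  data OnInnerface : Pred Fact 0ℓ where
    is-site   : ∀ {s} → OnInnerface (is-site s)
    is-i-name : ∀ {i} → OnInnerface (is-i-name i)
    prnt      : ∀ {s y} → OnInnerface (prnt (site s) y)
    link      : ∀ {i y} → OnInnerface (link (inner i) y)

  FactSet : Set₁
  FactSet = Pred Fact 0ℓ

  -- A fact on both faces, such as prnt (site s) (root r), is counted in `out`.
  out in′ core : PreBigraph → FactSet
  out  C f = f ∈ ⟦ C ⟧ × OnOuterface f
  in′  C f = f ∈ ⟦ C ⟧ × OnInnerface f × ¬ OnOuterface f
  core C f = f ∈ ⟦ C ⟧ × ¬ out C f × ¬ in′ C f

  data eq (C C′ : PreBigraph) : FactSet where
    prnt : ∀ {x y r s} → is-root r ∈ ⟦ C′ ⟧ → is-site s ∈ ⟦ C ⟧ → s ≡ r →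
           prnt x (root r) ∈ ⟦ C′ ⟧ → prnt (site s) y ∈ ⟦ C ⟧ → eq C C′ (prnt x y)
    link : ∀ {x y i o} → is-i-name i ∈ ⟦ C ⟧ → is-o-name o ∈ ⟦ C′ ⟧ → i ≡ o →
           link (inner i) y ∈ ⟦ C ⟧ → link x (outer o) ∈ ⟦ C′ ⟧ → eq C C′ (link x y)

  -- W is the set P, as a multi-set.
  record _Lists_ (W : Multiset) (P : FactSet) : Set where
    field
      once     : Unique W
      elements : ∀ f → f ∈ W ⇔ P f

  lhs rhs : (r : ReactionRule) → Reaction r → FactSet
  lhs (ground _) ρ = core (pre L₁) ∪ eq (pre C) (pre L₁)
    where open GroundReaction ρ
  lhs (parametric _) ρ =
    eq (pre C) ((pre D ⊗ pre L₁) ⊙ pre C′) ∪ core (pre L₁) ∪ core (pre D)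
      ∪ eq (pre D) (pre C′) ∪ eq (pre L₁) (pre C′) ∪ core (pre C′)
    where open ParametricReaction ρ
  rhs (ground _) ρ = core (pre R₁) ∪ eq (pre C) (pre R₁)
    where open GroundReaction ρ
  rhs (parametric _) ρ =
    eq (pre C) ((pre D ⊗ pre R₁) ⊙ pre ηC′) ∪ core (pre R₁) ∪ core (pre D)
      ∪ eq (pre D) (pre ηC′) ∪ eq (pre R₁) (pre ηC′) ∪ core (pre ηC′)
    where open ParametricReaction ρ

  -- The sites of the parameters are components of both composites, and the
  -- facts on them are in neither side of the modelled rule.  That each of them
  -- has the same name before and after the reaction means that these facts agree.
  SameSites : (r : ReactionRule) → Reaction r → Set
  SameSites (ground _)     ρ = ⊤
  SameSites (parametric _) ρ = in′ (pre C′) ≐ in′ (pre ηC′)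
    where open ParametricReaction ρ

  -- The decomposition uses the names of B itself, whence _≡ᴮ_ rather than _≏_.
  record ModelledRule (r : ReactionRule) (B : Bigraph) (W Z : Multiset) : Set where
    field
      reaction      : Reaction r
      decomposition : pre B ≡ᴮ before r reaction
      same-sites    : SameSites r reaction
      W-lists       : W Lists lhs r reaction
      Z-lists       : Z Lists rhs r reaction

{-# OPTIONS --safe #-}
module Submission where

-- Let B be C ⊙ M before the reaction, where M is the redex, in the parametric
-- case together with the parallel context D and the parameters F: M is L, or
-- (D ⊗ L) ⊙ F.  Let M′ be the same with the reactum and the instantiated
-- parameters.  The claim is that Y interprets to C ⊙ M′; as the interpretation is
-- unique up to the identity renaming, every B′ read off from Y is then the result
-- of the reaction.
--
-- A fact about components (nodes, ports, parents, links, ...; not a count) that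
-- holds of C ⊙ M has one of three origins (compose⁻, compose⁺): it is a fact of C
-- off its inner face, or a fact of M off its outer face, or it joins x → r in M to
-- r → y in C, which is what eq C M describes.  The modelled rule removes the joints
-- and the facts of M, and adds those of M′.  It leaves alone the facts of C, and
-- the facts of the parameters that are on their inner but not their outer face,
-- which are the same before and after.  This is the content of the record Side,
-- from which the lemma replacement concludes that Y contains every fact of
-- C ⊙ M′, and no nodes, ports, sites, roots, edges or names but those of C ⊙ M′.
--
-- The sets eq D F and eq L F of the modelled rule can contain facts that are not
-- facts of the composite, namely when the y of a joint is itself a root or an outer
-- name.  So it is not evident that every prnt, link, lc or lp fact in Y holds of
-- C ⊙ M′.  That follows from the validity of Y: each step of the reduction of a
-- valid set to the empty one removes one component together with exactly the prnt,
-- lc, lp and link facts that it must have (rule-balanced).  Hence in a valid set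
-- each component has at most one parent, control or link, and Y contains already
-- the one it has in C ⊙ M′.
--
-- In the parametric case the sites of D are shifted in D ⊗ L, whereas eq D F
-- matches them to the roots of F unshifted.  This is harmless: F has as many roots
-- as L has sites, so that D has no sites (context-no-sites).

open import Defs
open import Data.Empty using (⊥; ⊥-elim)
open import Data.Fin using (Fin)
open import Data.List using (List; []; _∷_; _++_; map; concatMap; fromMaybe; upTo)
open import Data.List.Membership.Propositional using (_∈_; _∉_; find; lose)
open import Data.List.Membership.Propositional.Properties
  using (∈-++⁺ˡ; ∈-++⁺ʳ; ∈-++⁻; ∈-concatMap⁺; ∈-concatMap⁻; ∈-map⁺; ∈-map⁻; ∈-upTo⁺; ∈-upTo⁻;
         ∈-deduplicate⁺; ∈-deduplicate⁻)
open import Data.List.Properties using (concatMap-++)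
open import Data.List.Relation.Binary.BagAndSetEquality using (>>=-cong; ↭⇒∼bag; ∼bag⇒↭)
open import Data.List.Relation.Binary.Disjoint.Propositional using (Disjoint)
open import Data.List.Relation.Binary.Permutation.Propositional
  using (_↭_; ↭-refl; ↭-sym; ↭-reflexive; ↭-trans; ↭⇒↭ₛ)
open import Data.List.Relation.Binary.Permutation.Propositional.Properties
  using (∈-resp-↭) renaming (++⁺ to ↭-++⁺)
import Data.List.Relation.Binary.Permutation.Setoid.Properties as PermutationSetoid
open import Data.List.Relation.Unary.All as All using (All; []; _∷_)
import Data.List.Relation.Unary.All.Properties as All
open import Data.List.Relation.Unary.AllPairs using ([]; _∷_)
open import Data.List.Relation.Unary.Any using (here; there)
open import Data.List.Relation.Unary.Unique.Propositional using (Unique)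
import Data.List.Relation.Unary.Unique.Propositional.Properties as Unique
open import Data.List.Relation.Unary.Unique.DecPropositional.Properties using (deduplicate-!)
open import Data.Maybe using (Maybe; just; nothing; maybe; _<∣>_)
import Data.Maybe as Maybe
open import Data.Maybe.Properties using (just-injective)
open import Data.Nat using (ℕ; _+_; _∸_; _<_; _<?_; _≟_)
open import Data.Nat.Properties
  using (<-irrefl; ≤-antisym; ≮⇒≥; <-≤-trans; m≤m+n; +-monoʳ-<; +-cancelˡ-<; m+[n∸m]≡n;
         +-cancelˡ-≡; +-identityʳ)
open import Data.Product using (Σ-syntax; ∃-syntax; _×_; _,_; proj₁; proj₂)
open import Data.Sum using (_⊎_; inj₁; inj₂; swap)
open import Function using (id; _∘_; case_of_)
open import Function.Bundles using (mk⇔; module Equivalence)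
open import Function.Related.Propositional using (K-refl)
open import Level using (0ℓ)
open import Relation.Binary.Construct.Closure.ReflexiveTransitive using (Star)
  renaming (ε to done; _◅_ to _then_)
open import Relation.Binary.Construct.Closure.Transitive using (TransClosure; [_]; _∷_)
open import Relation.Binary.Core using (Rel)
open import Relation.Binary.PropositionalEquality
  using (_≡_; refl; sym; trans; cong; subst; setoid)
open import Relation.Nullary using (¬_; yes; no)
open import Relation.Unary using (Pred; Decidable; _∪_; _≐_; ∅)

open Equivalence using (to; from)

-- Lists, partial functions and transitive closures

undefined : ∀ {A : Set} {m : Maybe A} → (∀ {a} → m ≡ just a → ⊥) → m ≡ nothing
undefined {m = nothing} h = refl
undefined {m = just _}  h = ⊥-elim (h refl)

<∣>-left : ∀ {A : Set} {m n : Maybe A} {a} → m ≡ just a → m <∣> n ≡ just a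
<∣>-left refl = refl

<∣>-right : ∀ {A : Set} {m n : Maybe A} {a} → m ≡ nothing → n ≡ just a → m <∣> n ≡ just a
<∣>-right refl eq = eq

<∣>-split : ∀ {A : Set} (m : Maybe A) {n a} → m <∣> n ≡ just a → m ≡ just a ⊎ n ≡ just a
<∣>-split (just _) eq = inj₁ eq
<∣>-split nothing  eq = inj₂ eq

map-just⁻ : ∀ {A B : Set} {g : A → B} {m b} → Maybe.map g m ≡ just b → ∃[ a ] m ≡ just a × g a ≡ b
map-just⁻ {m = just a} refl = a , refl , refl

∈-fromMaybe-map⁺ : ∀ {A B : Set} {g : A → B} {m a} → m ≡ just a → g a ∈ fromMaybe (Maybe.map g m)
∈-fromMaybe-map⁺ refl = here refl

All-fromMaybe-map : ∀ {A B : Set} {P : Pred B 0ℓ} {g : A → B} (m : Maybe A) →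
  (∀ {a} → m ≡ just a → P (g a)) → All P (fromMaybe (Maybe.map g m))
All-fromMaybe-map (just _) h = h refl ∷ []
All-fromMaybe-map nothing  h = []

All-concatMap : ∀ {A B : Set} {P : Pred B 0ℓ} {g : A → List B} xs →
  (∀ {x} → x ∈ xs → All P (g x)) → All P (concatMap g xs)
All-concatMap []       h = []
All-concatMap (x ∷ xs) h = All.++⁺ (h (here refl)) (All-concatMap xs (h ∘ there))

concatMap-↭ : ∀ {A B : Set} (g : A → List B) {xs ys} → xs ↭ ys → concatMap g xs ↭ concatMap g ys
concatMap-↭ g p = ∼bag⇒↭ (>>=-cong (↭⇒∼bag p) (λ _ → K-refl))

Unique-resp-↭ : ∀ {A : Set} {xs ys : List A} → xs ↭ ys → Unique xs → Unique ys
Unique-resp-↭ {A} p = PermutationSetoid.Unique-resp-↭ (setoid A) (↭⇒↭ₛ p)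

Unique-++⇒Disjoint : ∀ {A : Set} {xs ys : List A} → Unique (xs ++ ys) → Disjoint xs ys
Unique-++⇒Disjoint {xs = _ ∷ xs} (x∉ ∷ u) (here refl , v∈ys) = All.lookup x∉ (∈-++⁺ʳ xs v∈ys) refl
Unique-++⇒Disjoint {xs = _ ∷ _}  (_ ∷ u)  (there v∈  , v∈ys) = Unique-++⇒Disjoint u (v∈ , v∈ys)

Unique-concatMap⁺ : ∀ {A B : Set} {g : A → List B} {xs} → (∀ x → Unique (g x)) →
  (∀ {x y b} → b ∈ g x → b ∈ g y → x ≡ y) → Unique xs → Unique (concatMap g xs)
Unique-concatMap⁺ g! inj []                = []
Unique-concatMap⁺ {g = g} {xs = x ∷ xs} g! inj (x∉ ∷ u) =
  Unique.++⁺ (g! x) (Unique-concatMap⁺ g! inj u) λ (b∈gx , b∈) →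
    let y , y∈ , b∈gy = find (∈-concatMap⁻ g b∈) in All.lookup x∉ y∈ (inj b∈gx b∈gy)

Unique-concatMap⇒injective : ∀ {A B : Set} {g : A → List B} {xs x y b} → Unique (concatMap g xs) →
  x ∈ xs → y ∈ xs → b ∈ g x → b ∈ g y → x ≡ y
Unique-concatMap⇒injective u (here refl) (here refl) _ _ = refl
Unique-concatMap⇒injective {g = g} u (here refl) (there y∈) b∈gx b∈gy =
  ⊥-elim (Unique-++⇒Disjoint u (b∈gx , ∈-concatMap⁺ g (lose y∈ b∈gy)))
Unique-concatMap⇒injective {g = g} u (there x∈) (here refl) b∈gx b∈gy =
  ⊥-elim (Unique-++⇒Disjoint u (b∈gy , ∈-concatMap⁺ g (lose x∈ b∈gx)))
Unique-concatMap⇒injective {g = g} {xs = z ∷ _} u (there x∈) (there y∈) b∈gx b∈gy =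
  Unique-concatMap⇒injective (Unique-++⁻ʳ (g z) u) x∈ y∈ b∈gx b∈gy
  where
  Unique-++⁻ʳ : ∀ {A : Set} (xs : List A) {ys} → Unique (xs ++ ys) → Unique ys
  Unique-++⁻ʳ []       u       = u
  Unique-++⁻ʳ (_ ∷ xs) (_ ∷ u) = Unique-++⁻ʳ xs u

<-extensional : ∀ {m n} → (∀ i → i < m → i < n) → (∀ i → i < n → i < m) → m ≡ n
<-extensional {m} {n} m⊆n n⊆m = ≤-antisym
  (≮⇒≥ λ n<m → <-irrefl refl (m⊆n n n<m)) (≮⇒≥ λ m<n → <-irrefl refl (n⊆m m m<n))

-- A step of T is one of R inside P, one of S inside Q, or leads from P to Q.
-- As there is no way back from Q to P, a cycle would lie in R or in S.
acyclic-union : ∀ {A : Set} {P Q : Pred A 0ℓ} {R S T : Rel A 0ℓ} →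
  (∀ {x} → P x → Q x → ⊥) →
  (∀ {x y} → T x y → (R x y × P x × P y) ⊎ (S x y × Q x × Q y) ⊎ (P x × Q y)) →
  (∀ x → ¬ TransClosure R x x) → (∀ x → ¬ TransClosure S x x) → ∀ x → ¬ TransClosure T x x
acyclic-union {A} {P} {Q} {R} {S} {T} disjoint step R-acyclic S-acyclic x = conclude ∘ paths
  where
  Path : A → A → Set
  Path x y = (TransClosure R x y × P x × P y) ⊎ (TransClosure S x y × Q x × Q y) ⊎ (P x × Q y)

  paths : ∀ {x y} → TransClosure T x y → Path x y
  paths [ t ] with step t
  ... | inj₁ (r , p)        = inj₁ ([ r ] , p)
  ... | inj₂ (inj₁ (s , q)) = inj₂ (inj₁ ([ s ] , q))
  ... | inj₂ (inj₂ pq)      = inj₂ (inj₂ pq)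
  paths (t ∷ ts) with step t | paths ts
  ... | inj₁ (r , px , _)        | inj₁ (rs , _ , pz)        = inj₁ (r ∷ rs , px , pz)
  ... | inj₁ (_ , px , py)       | inj₂ (inj₁ (_ , qy , _))  = ⊥-elim (disjoint py qy)
  ... | inj₁ (_ , px , _)        | inj₂ (inj₂ (_ , qz))      = inj₂ (inj₂ (px , qz))
  ... | inj₂ (inj₁ (_ , _ , qy)) | inj₁ (_ , py , _)         = ⊥-elim (disjoint py qy)
  ... | inj₂ (inj₁ (s , qx , _)) | inj₂ (inj₁ (ss , _ , qz)) = inj₂ (inj₁ (s ∷ ss , qx , qz))
  ... | inj₂ (inj₁ (_ , _ , qy)) | inj₂ (inj₂ (py , _))      = ⊥-elim (disjoint py qy)
  ... | inj₂ (inj₂ (_ , qy))     | inj₁ (_ , py , _)         = ⊥-elim (disjoint py qy)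
  ... | inj₂ (inj₂ (px , _))     | inj₂ (inj₁ (_ , _ , qz))  = inj₂ (inj₂ (px , qz))
  ... | inj₂ (inj₂ (_ , qy))     | inj₂ (inj₂ (py , _))      = ⊥-elim (disjoint py qy)

  conclude : ¬ Path x x
  conclude (inj₁ (r , _))               = R-acyclic x r
  conclude (inj₂ (inj₁ (s , _)))        = S-acyclic x s
  conclude (inj₂ (inj₂ (px , qx)))      = disjoint px qx

module _ (𝒮 : Signature) where
  open Signature 𝒮
  open Bigraphs 𝒮

  private variable
    B G F C K : PreBigraph
    f f′ : Fact
    X Y W Z S T : Multiset

  -- Facts and attributes

  -- The facts that assert the existence of a component.
  data Component : Pred Fact 0ℓ where
    is-root   : ∀ {r} → Component (is-root r)
    is-node   : ∀ {v} → Component (is-node v)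
    is-site   : ∀ {s} → Component (is-site s)
    is-port   : ∀ {p} → Component (is-port p)
    is-o-name : ∀ {o} → Component (is-o-name o)
    is-i-name : ∀ {i} → Component (is-i-name i)
    is-e-name : ∀ {e} → Component (is-e-name e)

  -- What a bigraph assigns to a component by one of its functions.
  data Attribute : Set where
    place-of   : PlaceSrc → Attribute
    control-of : Node → Attribute
    node-of    : Port → Attribute
    link-of    : LinkSrc → Attribute

  -- The attribute, if any, whose value the fact gives.
  supplies : Fact → List Attribute
  supplies (prnt x _) = place-of x ∷ []
  supplies (lc v _)   = control-of v ∷ []
  supplies (lp p _)   = node-of p ∷ []
  supplies (link x _) = link-of x ∷ []
  supplies _          = []

  -- The attributes that the component must have.  Their order is that in which the
  -- validity rules list the facts that supply them.
  demands : Fact → List Attribute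
  demands (is-node v)   = place-of (node v) ∷ control-of v ∷ []
  demands (is-site s)   = place-of (site s) ∷ []
  demands (is-port p)   = node-of p ∷ link-of (port p) ∷ []
  demands (is-i-name i) = link-of (inner i) ∷ []
  demands _             = []

  -- The only fact that demands the attribute.
  demander : Attribute → Fact
  demander (place-of (node v))  = is-node v
  demander (place-of (site s))  = is-site s
  demander (control-of v)       = is-node v
  demander (node-of p)          = is-port p
  demander (link-of (inner i))  = is-i-name i
  demander (link-of (port p))   = is-port p

  -- All facts but the counts has-child-p, has-child-l and vp.
  data Structural : Pred Fact 0ℓ where
    component : Component f → Structural f
    attribute : ∀ {k} → k ∈ supplies f → Structural f

  -- The truth of a fact in a bigraph, stated without its encoding.  A count never
  -- holds: interpretation ignores the counts.
  Holds : PreBigraph → Pred Fact 0ℓ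
  Holds B (is-root r)       = r < roots B
  Holds B (is-node v)       = v ∈ nodes B
  Holds B (is-site s)       = s < sites B
  Holds B (is-port p)       = IsPort B p
  Holds B (is-o-name o)     = o ∈ outerNames B
  Holds B (is-i-name i)     = i ∈ innerNames B
  Holds B (is-e-name e)     = e ∈ edges B
  Holds B (prnt x y)        = parent B x ≡ just y
  Holds B (link x y)        = linkTo B x ≡ just y
  Holds B (lc v k)          = ctrl B v ≡ just k
  Holds B (lp p v)          = IsPort B p × proj₁ p ≡ v
  Holds B (has-child-p _ _) = ⊥
  Holds B (has-child-l _ _) = ⊥
  Holds B (vp _ _)          = ⊥

  demander-component : ∀ k → Component (demander k)
  demander-component (place-of (node _)) = is-node
  demander-component (place-of (site _)) = is-site
  demander-component (control-of _)      = is-node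
  demander-component (node-of _)         = is-port
  demander-component (link-of (inner _)) = is-i-name
  demander-component (link-of (port _))  = is-port

  demands⇒demander : ∀ {k} f → k ∈ demands f → f ≡ demander k
  demands⇒demander (is-node _)   (here refl)         = refl
  demands⇒demander (is-node _)   (there (here refl)) = refl
  demands⇒demander (is-site _)   (here refl)         = refl
  demands⇒demander (is-port _)   (here refl)         = refl
  demands⇒demander (is-port _)   (there (here refl)) = refl
  demands⇒demander (is-i-name _) (here refl)         = refl

  demands-unique : ∀ f → Unique (demands f)
  demands-unique (is-node _)   = ((λ ()) ∷ []) ∷ [] ∷ []
  demands-unique (is-site _)   = [] ∷ []
  demands-unique (is-port _)   = ((λ ()) ∷ []) ∷ [] ∷ []
  demands-unique (is-i-name _) = [] ∷ []
  demands-unique (is-root _)   = []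
  demands-unique (is-o-name _) = []
  demands-unique (is-e-name _) = []
  demands-unique (prnt _ _)    = []
  demands-unique (link _ _)    = []
  demands-unique (lc _ _)      = []
  demands-unique (lp _ _)      = []
  demands-unique (has-child-p _ _) = []
  demands-unique (has-child-l _ _) = []
  demands-unique (vp _ _)          = []

  holds⇒structural : ∀ f → Holds B f → Structural f
  holds⇒structural (is-root _)   _ = component is-root
  holds⇒structural (is-node _)   _ = component is-node
  holds⇒structural (is-site _)   _ = component is-site
  holds⇒structural (is-port _)   _ = component is-port
  holds⇒structural (is-o-name _) _ = component is-o-name
  holds⇒structural (is-i-name _) _ = component is-i-name
  holds⇒structural (is-e-name _) _ = component is-e-name
  holds⇒structural (prnt _ _)    _ = attribute (here refl)
  holds⇒structural (link _ _)    _ = attribute (here refl)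
  holds⇒structural (lc _ _)      _ = attribute (here refl)
  holds⇒structural (lp _ _)      _ = attribute (here refl)

  inner⇒structural : OnInnerface f → Structural f
  inner⇒structural is-site   = component is-site
  inner⇒structural is-i-name = component is-i-name
  inner⇒structural prnt      = attribute (here refl)
  inner⇒structural link      = attribute (here refl)

  onInnerface? : Decidable OnInnerface
  onInnerface? (is-site _)       = yes is-site
  onInnerface? (is-i-name _)     = yes is-i-name
  onInnerface? (prnt (site _) _) = yes prnt
  onInnerface? (prnt (node _) _) = no λ ()
  onInnerface? (link (inner _) _) = yes link
  onInnerface? (link (port _) _) = no λ ()
  onInnerface? (is-root _)       = no λ ()
  onInnerface? (is-node _)       = no λ ()
  onInnerface? (is-port _)       = no λ ()
  onInnerface? (is-o-name _)     = no λ ()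
  onInnerface? (is-e-name _)     = no λ ()
  onInnerface? (lc _ _)          = no λ ()
  onInnerface? (lp _ _)          = no λ ()
  onInnerface? (has-child-p _ _) = no λ ()
  onInnerface? (has-child-l _ _) = no λ ()
  onInnerface? (vp _ _)          = no λ ()

  -- The encoding contains the facts that hold

  count-free : {A : Set} → ¬ Component f → supplies f ≡ [] → Structural f → A
  count-free ¬c _ (component c) = ⊥-elim (¬c c)
  count-free {f = f} _ eq (attribute {k = k} k∈) = case subst (k ∈_) eq k∈ of λ ()

  ⟦⟧⁻ : f ∈ ⟦ B ⟧ → Structural f → Holds B f
  ⟦⟧⁻ {B = B} = All.lookup sound
    where
    P : Pred Fact 0ℓ
    P f = Structural f → Holds B f

    port⁻ : ∀ {p} → p ∈ ports B → IsPort B p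
    port⁻ p∈ with v , _ , p∈v ← find (∈-concatMap⁻ _ {xs = nodes B} p∈) with ctrl B v in eq
    ... | just k with i , i∈ , refl ← ∈-map⁻ (v ,_) p∈v = k , eq , ∈-upTo⁻ i∈

    sound : All P ⟦ B ⟧
    sound =
      All.++⁺ (All-concatMap (upTo (roots B)) λ r∈ →
        (λ _ → ∈-upTo⁻ r∈) ∷ count-free (λ ()) refl ∷ []) (
      All.++⁺ (All-concatMap (nodes B) λ {v} v∈ →
        (λ _ → v∈) ∷ count-free (λ ()) refl
        ∷ All.++⁺ (All-fromMaybe-map (ctrl B v) λ eq _ → eq)
                  (All-fromMaybe-map (parent B (node v)) λ eq _ → eq)) (
      All.++⁺ (All-concatMap (upTo (sites B)) λ {s} s∈ →
        (λ _ → ∈-upTo⁻ s∈) ∷ All-fromMaybe-map (parent B (site s)) λ eq _ → eq) (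
      All.++⁺ (All-concatMap (ports B) λ {p} p∈ →
        (λ _ → port⁻ p∈) ∷ (λ _ → port⁻ p∈ , refl)
        ∷ All-fromMaybe-map (linkTo B (port p)) λ eq _ → eq) (
      All.++⁺ (All-concatMap (outerNames B) λ o∈ →
        (λ _ → o∈) ∷ count-free (λ ()) refl ∷ []) (
      All.++⁺ (All-concatMap (edges B) λ e∈ →
        (λ _ → e∈) ∷ count-free (λ ()) refl ∷ [])
      (All-concatMap (innerNames B) λ {i} i∈ →
        (λ _ → i∈) ∷ All-fromMaybe-map (linkTo B (inner i)) λ eq _ → eq))))))

  ports⁺ : IsBigraph B → ∀ {p} → IsPort B p → p ∈ ports B
  ports⁺ {B = B} b {v , i} (k , eq , i<) =
    ∈-concatMap⁺ _ (lose (from (IsBigraph.ctrl-domain b v) (k , eq)) ports-of-v)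
    where
    ports-of-v : (v , i) ∈ maybe (λ k → map (v ,_) (upTo (arity k))) [] (ctrl B v)
    ports-of-v rewrite eq = ∈-map⁺ (v ,_) (∈-upTo⁺ i<)

  ⟦⟧⁺ : IsBigraph B → ∀ f → Holds B f → f ∈ ⟦ B ⟧
  ⟦⟧⁺ {B = B} b = encoded
    where
    open IsBigraph b

    rootFacts nodeFacts siteFacts outerFacts edgeFacts innerFacts : ℕ → List Fact
    rootFacts r  = is-root r ∷ has-child-p (root r) (#children B (root r)) ∷ []
    nodeFacts v  = is-node v ∷ has-child-p (node v) (#children B (node v))
      ∷ fromMaybe (Maybe.map (lc v) (ctrl B v))
        ++ fromMaybe (Maybe.map (prnt (node v)) (parent B (node v)))
    siteFacts s  = is-site s ∷ fromMaybe (Maybe.map (prnt (site s)) (parent B (site s)))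
    outerFacts o = is-o-name o ∷ has-child-l (outer o) (#points B (outer o)) ∷ []
    edgeFacts e  = is-e-name e ∷ has-child-l (edge e) (#points B (edge e)) ∷ []
    innerFacts i = is-i-name i ∷ fromMaybe (Maybe.map (link (inner i)) (linkTo B (inner i)))

    portFacts : Port → List Fact
    portFacts p = is-port p ∷ lp p (proj₁ p)
      ∷ fromMaybe (Maybe.map (link (port p)) (linkTo B (port p)))

    entry : ∀ {A : Set} (g : A → List Fact) {xs x} → x ∈ xs → f ∈ g x → f ∈ concatMap g xs
    entry g x∈ f∈ = ∈-concatMap⁺ g (lose x∈ f∈)

    skip-roots : f ∈ T → f ∈ concatMap rootFacts (upTo (roots B)) ++ T
    skip-roots = ∈-++⁺ʳ (concatMap rootFacts (upTo (roots B)))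
    skip-nodes : f ∈ T → f ∈ concatMap nodeFacts (nodes B) ++ T
    skip-nodes = ∈-++⁺ʳ (concatMap nodeFacts (nodes B))
    skip-sites : f ∈ T → f ∈ concatMap siteFacts (upTo (sites B)) ++ T
    skip-sites = ∈-++⁺ʳ (concatMap siteFacts (upTo (sites B)))
    skip-ports : f ∈ T → f ∈ concatMap portFacts (ports B) ++ T
    skip-ports = ∈-++⁺ʳ (concatMap portFacts (ports B))
    skip-outer : f ∈ T → f ∈ concatMap outerFacts (outerNames B) ++ T
    skip-outer = ∈-++⁺ʳ (concatMap outerFacts (outerNames B))
    skip-edges : f ∈ T → f ∈ concatMap edgeFacts (edges B) ++ T
    skip-edges = ∈-++⁺ʳ (concatMap edgeFacts (edges B))

    on-node : ∀ {v} → v ∈ nodes B → f ∈ nodeFacts v → f ∈ ⟦ B ⟧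
    on-node h f∈ = skip-roots (∈-++⁺ˡ (entry nodeFacts h f∈))

    on-site : ∀ {s} → s < sites B → f ∈ siteFacts s → f ∈ ⟦ B ⟧
    on-site h f∈ = skip-roots (skip-nodes (∈-++⁺ˡ (entry siteFacts (∈-upTo⁺ h) f∈)))

    on-port : ∀ {p} → IsPort B p → f ∈ portFacts p → f ∈ ⟦ B ⟧
    on-port h f∈ =
      skip-roots (skip-nodes (skip-sites (∈-++⁺ˡ (entry portFacts (ports⁺ b h) f∈))))

    on-inner : ∀ {i} → i ∈ innerNames B → f ∈ innerFacts i → f ∈ ⟦ B ⟧
    on-inner h f∈ = skip-roots (skip-nodes (skip-sites (skip-ports (skip-outer (skip-edges
      (entry innerFacts h f∈))))))

    encoded : ∀ f → Holds B f → f ∈ ⟦ B ⟧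
    encoded (is-root r) h        = ∈-++⁺ˡ (entry rootFacts (∈-upTo⁺ h) (here refl))
    encoded (is-node v) h        = on-node h (here refl)
    encoded (is-site s) h        = on-site h (here refl)
    encoded (is-port p) h        = on-port h (here refl)
    encoded (is-o-name o) h      = skip-roots (skip-nodes (skip-sites (skip-ports
      (∈-++⁺ˡ (entry outerFacts h (here refl))))))
    encoded (is-i-name i) h      = on-inner h (here refl)
    encoded (is-e-name e) h      = skip-roots (skip-nodes (skip-sites (skip-ports (skip-outer
      (∈-++⁺ˡ (entry edgeFacts h (here refl)))))))
    encoded (prnt (node v) y) h  = on-node (from (parent-domain (node v)) (y , h))
      (there (there (∈-++⁺ʳ (fromMaybe (Maybe.map (lc v) (ctrl B v))) (∈-fromMaybe-map⁺ h))))
    encoded (prnt (site s) y) h  = on-site (from (parent-domain (site s)) (y , h))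
      (there (∈-fromMaybe-map⁺ h))
    encoded (link (inner i) y) h = on-inner (from (linkTo-domain (inner i)) (y , h))
      (there (∈-fromMaybe-map⁺ h))
    encoded (link (port p) y) h  = on-port (from (linkTo-domain (port p)) (y , h))
      (there (there (∈-fromMaybe-map⁺ h)))
    encoded (lc v k) h           = on-node (from (ctrl-domain v) (k , h))
      (there (there (∈-++⁺ˡ (∈-fromMaybe-map⁺ {g = lc v} h))))
    encoded (lp p _) (h , refl)  = on-port h (there (here refl))

  -- Sets of facts determined by their components

  -- Every attribute given belongs to a component present, and is given once.
  record WellFormed (Q : Pred Fact 0ℓ) : Set where
    field
      demanded   : ∀ {k} → Q f → k ∈ supplies f → Q (demander k)
      functional : ∀ {k} → Q f → Q f′ → k ∈ supplies f → k ∈ supplies f′ → f ≡ f′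

  -- Every component present is given all its attributes.
  Total : Pred Fact 0ℓ → Set
  Total P = ∀ k → P (demander k) → ∃[ f ] k ∈ supplies f × P f

  -- If P is contained in Q and has the components of Q, it has the attributes of Q as
  -- well: an attribute in Q has a component in P, hence a value in P, and that value
  -- is the one in Q.
  attributes-determined : {P Q : Pred Fact 0ℓ} → WellFormed Q → Total P →
    (∀ f → P f → Q f) → (∀ {f} → Component f → Q f → P f) → ∀ {f} → Structural f → Q f → P f
  attributes-determined wf total P⊆Q sound (component c)           q = sound c q
  attributes-determined {P} wf total P⊆Q sound (attribute {k = k} k∈) q
    with f′ , k∈f′ , p ← total k (sound (demander-component k) (WellFormed.demanded wf q k∈))
    = subst P (WellFormed.functional wf (P⊆Q f′ p) q k∈f′ k∈) p

  holds-wellFormed : IsBigraph B → WellFormed (Holds B)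
  holds-wellFormed {B = B} b =
    record { demanded = λ {f} → demanded f ; functional = functional _ _ }
    where
    open IsBigraph b

    demanded : ∀ f {k} → Holds B f → k ∈ supplies f → Holds B (demander k)
    demanded (prnt (node v) y) h (here refl)  = from (parent-domain (node v)) (y , h)
    demanded (prnt (site s) y) h (here refl)  = from (parent-domain (site s)) (y , h)
    demanded (link (inner i) y) h (here refl) = from (linkTo-domain (inner i)) (y , h)
    demanded (link (port p) y) h (here refl)  = from (linkTo-domain (port p)) (y , h)
    demanded (lc v k) h (here refl)           = from (ctrl-domain v) (k , h)
    demanded (lp p _) (h , _) (here refl)     = h

    value : Attribute → Maybe Fact
    value (place-of x)   = Maybe.map (prnt x) (parent B x)
    value (link-of x)    = Maybe.map (link x) (linkTo B x)
    value (control-of v) = Maybe.map (lc v) (ctrl B v)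
    value (node-of p)    = just (lp p (proj₁ p))

    value-unique : ∀ f {k} → Holds B f → k ∈ supplies f → value k ≡ just f
    value-unique (prnt x _) h (here refl)          = cong (Maybe.map (prnt x)) h
    value-unique (link x _) h (here refl)          = cong (Maybe.map (link x)) h
    value-unique (lc v _) h (here refl)            = cong (Maybe.map (lc v)) h
    value-unique (lp p _) (_ , refl) (here refl)   = refl

    functional : ∀ f f′ {k} → Holds B f → Holds B f′ → k ∈ supplies f → k ∈ supplies f′ → f ≡ f′
    functional f f′ h h′ k∈f k∈f′ =
      just-injective (trans (sym (value-unique f h k∈f)) (value-unique f′ h′ k∈f′))

  holds-total : IsBigraph B → Total (Holds B)
  holds-total {B = B} b = total
    where
    open IsBigraph b

    total : Total (Holds B)
    total (place-of (node v)) h = let y , eq = to (parent-domain (node v)) h in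
      prnt (node v) y , here refl , eq
    total (place-of (site s)) h = let y , eq = to (parent-domain (site s)) h in
      prnt (site s) y , here refl , eq
    total (link-of (inner i)) h = let y , eq = to (linkTo-domain (inner i)) h in
      link (inner i) y , here refl , eq
    total (link-of (port p)) h  = let y , eq = to (linkTo-domain (port p)) h in
      link (port p) y , here refl , eq
    total (control-of v) h      = let k , eq = to (ctrl-domain v) h in lc v k , here refl , eq
    total (node-of p) h         = lp p (proj₁ p) , here refl , h , refl

  -- Valid multi-sets

  -- Each rule removes a component together with the facts that give the attributes
  -- it demands.
  rule-balanced : ValidityRule W Z → concatMap demands W ≡ concatMap supplies W
  rule-balanced root₀         = refl
  rule-balanced outer₀        = refl
  rule-balanced edge₀         = refl
  rule-balanced port₁         = refl
  rule-balanced innerName     = refl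
  rule-balanced site₁         = refl
  rule-balanced (node₀ _)     = refl
  rule-balanced (node₊ _ _)   = refl
  rule-balanced port₊         = refl

  result-attribute-free : ValidityRule W Z → concatMap demands Z ≡ [] × concatMap supplies Z ≡ []
  result-attribute-free root₀       = refl , refl
  result-attribute-free outer₀      = refl , refl
  result-attribute-free edge₀       = refl , refl
  result-attribute-free port₁       = refl , refl
  result-attribute-free innerName   = refl , refl
  result-attribute-free site₁       = refl , refl
  result-attribute-free (node₀ _)   = refl , refl
  result-attribute-free (node₊ _ _) = refl , refl
  result-attribute-free port₊       = refl , refl

  -- The balance holds of the empty set, and each step of a reduction, read
  -- backwards, adds a balanced multi-set and takes away one without attributes.
  balanced : Star _↦_ S [] → concatMap demands S ↭ concatMap supplies S
  balanced done = ↭-refl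
  balanced (_then_ {i = S} {j = T} (W , Z , rule , rw) steps) =
    ↭-trans (concatMap-↭ demands S≡W⊎Δ) (↭-trans (↭-reflexive (concatMap-++ demands W Δ)) (
    ↭-trans (↭-++⁺ (↭-reflexive (rule-balanced rule)) remainder) (
    ↭-trans (↭-reflexive (sym (concatMap-++ supplies W Δ)))
            (↭-sym (concatMap-↭ supplies S≡W⊎Δ)))))
    where
    open Rewrites rw

    only-Δ : ∀ (g : Fact → List Attribute) → concatMap g Z ≡ [] → concatMap g T ↭ concatMap g Δ
    only-Δ g eq = ↭-trans (concatMap-↭ g T≡Z⊎Δ)
      (↭-reflexive (trans (concatMap-++ g Z Δ) (cong (_++ concatMap g Δ) eq)))

    remainder : concatMap demands Δ ↭ concatMap supplies Δ
    remainder = ↭-trans (↭-sym (only-Δ demands (proj₁ (result-attribute-free rule))))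
      (↭-trans (balanced steps) (only-Δ supplies (proj₂ (result-attribute-free rule))))

  valid-wellFormed : Valid S → WellFormed (_∈ S)
  valid-wellFormed {S = S} valid = record { demanded = demanded ; functional = functional }
    where
    open Valid valid

    demanded : ∀ {f k} → f ∈ S → k ∈ supplies f → demander k ∈ S
    demanded f∈ k∈ =
      let f′ , f′∈ , k∈f′ = find (∈-concatMap⁻ demands (∈-resp-↭ (↭-sym (balanced reduces))
                              (∈-concatMap⁺ supplies (lose f∈ k∈))))
      in subst (_∈ S) (demands⇒demander f′ k∈f′) f′∈

    supplies-unique : Unique (concatMap supplies S)
    supplies-unique = Unique-resp-↭ (balanced reduces) (Unique-concatMap⁺ demands-unique
      (λ {f} {f′} k∈f k∈f′ → trans (demands⇒demander f k∈f) (sym (demands⇒demander f′ k∈f′)))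
      multiplicity-one)

    functional : ∀ {f f′ k} → f ∈ S → f′ ∈ S → k ∈ supplies f → k ∈ supplies f′ → f ≡ f′
    functional = Unique-concatMap⇒injective {g = supplies} supplies-unique

  -- Interpretation and equality of bigraphs

  interpreted⁺ : ∀ {B} → X ⟦⟧⋆ B → ∀ f → Holds (pre B) f → f ∈ X
  interpreted⁺ i (is-root r)   = to (_⟦⟧⋆_.roots⋆ i r)
  interpreted⁺ i (is-node v)   = to (_⟦⟧⋆_.nodes⋆ i v)
  interpreted⁺ i (is-site s)   = to (_⟦⟧⋆_.sites⋆ i s)
  interpreted⁺ i (is-port p)   = to (_⟦⟧⋆_.ports⋆ i p)
  interpreted⁺ i (is-o-name o) = to (_⟦⟧⋆_.outer⋆ i o)
  interpreted⁺ i (is-i-name x) = to (_⟦⟧⋆_.inner⋆ i x)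
  interpreted⁺ i (is-e-name e) = to (_⟦⟧⋆_.edges⋆ i e)
  interpreted⁺ i (prnt x y)    = to (_⟦⟧⋆_.parent⋆ i x y)
  interpreted⁺ i (link x y)    = to (_⟦⟧⋆_.link⋆ i x y)
  interpreted⁺ i (lc v k)      = to (_⟦⟧⋆_.ctrl⋆ i v k)
  interpreted⁺ i (lp p v)      = to (_⟦⟧⋆_.lp⋆ i p v)
  interpreted⁺ i (has-child-p _ _) ()
  interpreted⁺ i (has-child-l _ _) ()
  interpreted⁺ i (vp _ _) ()

  interpreted⁻ : ∀ {B} → X ⟦⟧⋆ B → ∀ f → Structural f → f ∈ X → Holds (pre B) f
  interpreted⁻ i (is-root r)   _ = from (_⟦⟧⋆_.roots⋆ i r)
  interpreted⁻ i (is-node v)   _ = from (_⟦⟧⋆_.nodes⋆ i v)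
  interpreted⁻ i (is-site s)   _ = from (_⟦⟧⋆_.sites⋆ i s)
  interpreted⁻ i (is-port p)   _ = from (_⟦⟧⋆_.ports⋆ i p)
  interpreted⁻ i (is-o-name o) _ = from (_⟦⟧⋆_.outer⋆ i o)
  interpreted⁻ i (is-i-name x) _ = from (_⟦⟧⋆_.inner⋆ i x)
  interpreted⁻ i (is-e-name e) _ = from (_⟦⟧⋆_.edges⋆ i e)
  interpreted⁻ i (prnt x y)    _ = from (_⟦⟧⋆_.parent⋆ i x y)
  interpreted⁻ i (link x y)    _ = from (_⟦⟧⋆_.link⋆ i x y)
  interpreted⁻ i (lc v k)      _ = from (_⟦⟧⋆_.ctrl⋆ i v k)
  interpreted⁻ i (lp p v)      _ = from (_⟦⟧⋆_.lp⋆ i p v)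
  interpreted⁻ i (has-child-p _ _) = count-free (λ ()) refl
  interpreted⁻ i (has-child-l _ _) = count-free (λ ()) refl
  interpreted⁻ i (vp _ _)          = count-free (λ ()) refl

  same-facts⇒interpreted : ∀ {B} → (∀ f → Holds (pre B) f → f ∈ X) →
    (∀ {f} → Structural f → f ∈ X → Holds (pre B) f) → X ⟦⟧⋆ B
  same-facts⇒interpreted ⊆X X⊆ = record
    { nodes⋆  = λ v → mk⇔ (⊆X (is-node v)) (X⊆ (component is-node))
    ; edges⋆  = λ e → mk⇔ (⊆X (is-e-name e)) (X⊆ (component is-e-name))
    ; ports⋆  = λ p → mk⇔ (⊆X (is-port p)) (X⊆ (component is-port))
    ; roots⋆  = λ r → mk⇔ (⊆X (is-root r)) (X⊆ (component is-root))
    ; sites⋆  = λ s → mk⇔ (⊆X (is-site s)) (X⊆ (component is-site))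
    ; outer⋆  = λ o → mk⇔ (⊆X (is-o-name o)) (X⊆ (component is-o-name))
    ; inner⋆  = λ i → mk⇔ (⊆X (is-i-name i)) (X⊆ (component is-i-name))
    ; lp⋆     = λ p v → mk⇔ (⊆X (lp p v)) (X⊆ (attribute (here refl)))
    ; ctrl⋆   = λ v k → mk⇔ (⊆X (lc v k)) (X⊆ (attribute (here refl)))
    ; parent⋆ = λ x y → mk⇔ (⊆X (prnt x y)) (X⊆ (attribute (here refl)))
    ; link⋆   = λ x y → mk⇔ (⊆X (link x y)) (X⊆ (attribute (here refl)))
    }

  renamePlaceSrc-id : ∀ x → renamePlaceSrc id x ≡ x
  renamePlaceSrc-id (node _) = refl
  renamePlaceSrc-id (site _) = refl

  renamePlaceDst-id : ∀ y → renamePlaceDst id y ≡ y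
  renamePlaceDst-id (node _) = refl
  renamePlaceDst-id (root _) = refl

  renameLinkSrc-id : ∀ x → renameLinkSrc id x ≡ x
  renameLinkSrc-id (inner _) = refl
  renameLinkSrc-id (port _)  = refl

  renameLinkDst-id : ∀ y → renameLinkDst id y ≡ y
  renameLinkDst-id (outer _) = refl
  renameLinkDst-id (edge _)  = refl

  same-facts⇒≡ᴮ : IsBigraph B → (∀ f → Holds B f → Holds G f) → (∀ f → Holds G f → Holds B f) →
    B ≡ᴮ G
  same-facts⇒≡ᴮ {B = B} {G = G} b B⊆G G⊆B = record
    { same-innerface  = <-extensional (B⊆G ∘ is-site) (G⊆B ∘ is-site)
                      , λ {i} → mk⇔ (B⊆G (is-i-name i)) (G⊆B (is-i-name i))
    ; same-outerface  = <-extensional (B⊆G ∘ is-root) (G⊆B ∘ is-root)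
                      , λ {o} → mk⇔ (B⊆G (is-o-name o)) (G⊆B (is-o-name o))
    ; nodes-bijection = identity (B⊆G ∘ is-node) (G⊆B ∘ is-node)
    ; edges-bijection = identity (B⊆G ∘ is-e-name) (G⊆B ∘ is-e-name)
    ; ctrl-commutes   = λ {v} h → let k , eq = to (ctrl-domain v) h in
        trans (B⊆G (lc v k) eq) (sym eq)
    ; parent-commutes = λ {x} h → let y , eq = to (parent-domain x) h in
        trans (cong (parent G) (renamePlaceSrc-id x)) (trans (B⊆G (prnt x y) eq)
          (trans (cong just (sym (renamePlaceDst-id y))) (cong (Maybe.map _) (sym eq))))
    ; linkTo-commutes = λ {x} h → let y , eq = to (linkTo-domain x) h in
        trans (cong (linkTo G) (renameLinkSrc-id x)) (trans (B⊆G (link x y) eq)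
          (trans (cong just (sym (renameLinkDst-id y))) (cong (Maybe.map _) (sym eq))))
    }
    where
    open IsBigraph b

    identity : ∀ {xs ys} → (∀ x → x ∈ xs → x ∈ ys) → (∀ x → x ∈ ys → x ∈ xs) →
      BijectionOn id xs ys
    identity xs⊆ys ys⊆xs = record
      { maps-to    = xs⊆ys _
      ; injective  = λ _ _ eq → eq
      ; surjective = λ {y} y∈ → y , ys⊆xs y y∈ , refl
      }

  ≡ᴮ⇒holds⁺ : IsBigraph B → B ≡ᴮ G → ∀ f → Holds B f → Holds G f
  ≡ᴮ⇒holds⁺ {B = B} {G = G} b B≡G = same
    where
    open IsBigraph b
    open LeanEquivalence B≡G

    same : ∀ f → Holds B f → Holds G f
    same (is-root r) h          = subst (r <_) (proj₁ same-outerface) h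
    same (is-node v) h          = BijectionOn.maps-to nodes-bijection h
    same (is-site s) h          = subst (s <_) (proj₁ same-innerface) h
    same (is-port (v , _)) (k , eq , i<) =
      k , trans (ctrl-commutes (from (ctrl-domain v) (k , eq))) eq , i<
    same (is-o-name _) h        = to (proj₂ same-outerface) h
    same (is-i-name _) h        = to (proj₂ same-innerface) h
    same (is-e-name _) h        = BijectionOn.maps-to edges-bijection h
    same (prnt x y) h           =
      trans (cong (parent G) (sym (renamePlaceSrc-id x)))
        (trans (parent-commutes (from (parent-domain x) (y , h)))
          (trans (cong (Maybe.map _) h) (cong just (renamePlaceDst-id y))))
    same (link x y) h           =
      trans (cong (linkTo G) (sym (renameLinkSrc-id x)))
        (trans (linkTo-commutes (from (linkTo-domain x) (y , h)))
          (trans (cong (Maybe.map _) h) (cong just (renameLinkDst-id y))))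
    same (lc v k) h             = trans (ctrl-commutes (from (ctrl-domain v) (k , h))) h
    same (lp p _) (h , refl)    = same (is-port p) h , refl

  ≡ᴮ⇒holds⁻ : IsBigraph B → IsBigraph G → B ≡ᴮ G → ∀ f → Holds G f → Holds B f
  ≡ᴮ⇒holds⁻ {B = B} {G = G} b g B≡G f h =
    attributes-determined (holds-wellFormed g) (holds-total b) (≡ᴮ⇒holds⁺ b B≡G) components
      (holds⇒structural f h) h
    where
    open LeanEquivalence B≡G

    node⁻ : ∀ {v} → v ∈ nodes G → v ∈ nodes B
    node⁻ h with _ , v∈ , refl ← BijectionOn.surjective nodes-bijection h = v∈

    components : ∀ {f} → Component f → Holds G f → Holds B f
    components is-root h         = subst (_ <_) (sym (proj₁ same-outerface)) h
    components is-node h         = node⁻ h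
    components is-site h         = subst (_ <_) (sym (proj₁ same-innerface)) h
    components (is-port {v , _}) (k , eq , i<) =
      k , trans (sym (ctrl-commutes (node⁻ (from (IsBigraph.ctrl-domain g v) (k , eq))))) eq , i<
    components is-o-name h       = from (proj₂ same-outerface) h
    components is-i-name h       = from (proj₂ same-innerface) h
    components is-e-name h with _ , e∈ , refl ← BijectionOn.surjective edges-bijection h = e∈

  -- What G defines on its nodes and ports, F leaves undefined.
  module NodesDisjoint {G F : PreBigraph} (g : IsBigraph G) (b : IsBigraph F)
                       (disjoint : Disjoint (nodes G) (nodes F)) where
    private
      module G = IsBigraph g
      module F = IsBigraph b

    ctrl-absent : ∀ {v k} → ctrl G v ≡ just k → ctrl F v ≡ nothing
    ctrl-absent {v} eq = undefined λ eqF →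
      disjoint (from (G.ctrl-domain v) (_ , eq) , from (F.ctrl-domain v) (_ , eqF))

    parent-absent : ∀ {v y} → parent G (node v) ≡ just y → parent F (node v) ≡ nothing
    parent-absent {v} eq = undefined λ eqF → disjoint
      (from (G.parent-domain (node v)) (_ , eq) , from (F.parent-domain (node v)) (_ , eqF))

    linkTo-absent : ∀ {p y} → linkTo G (port p) ≡ just y → linkTo F (port p) ≡ nothing
    linkTo-absent {p} eq = undefined λ eqF →
      let _ , ctrlG , _ = from (G.linkTo-domain (port p)) (_ , eq)
          _ , ctrlF , _ = from (F.linkTo-domain (port p)) (_ , eqF)
      in disjoint (from (G.ctrl-domain _) (_ , ctrlG) , from (F.ctrl-domain _) (_ , ctrlF))

  -- Composition

  -- The facts of G ⊙ F that arise at the interface; the semantic form of eq G F.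
  data Joined (G F : PreBigraph) : Pred Fact 0ℓ where
    prnt : ∀ {x y r} → parent F x ≡ just (root r) → parent G (site r) ≡ just y →
           Joined G F (prnt x y)
    link : ∀ {x y o} → linkTo F x ≡ just (outer o) → linkTo G (inner o) ≡ just y →
           Joined G F (link x y)

  -- The origins of the facts of G ⊙ F.  Facts on the inner face of G and on the outer
  -- face of F do not survive composition, except through Joined.
  data Composed (G F : PreBigraph) (f : Fact) : Set where
    from-outer : Holds G f → ¬ OnInnerface f → Composed G F f
    from-inner : Holds F f → ¬ OnOuterface f → Composed G F f
    joined     : Joined G F f → Composed G F f

  compose⁻ : ∀ f → Holds (G ⊙ F) f → Composed G F f
  compose⁻ {G = G} {F = F} = split
    where
    split : ∀ f → Holds (G ⊙ F) f → Composed G F f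
    split (is-root _) h   = from-outer h λ ()
    split (is-node _) h with ∈-++⁻ (nodes G) h
    ... | inj₁ v∈ = from-outer v∈ λ ()
    ... | inj₂ v∈ = from-inner v∈ λ ()
    split (is-site _) h   = from-inner h λ ()
    split (is-port (v , _)) (k , eq , i<) with <∣>-split (ctrl F v) eq
    ... | inj₁ eqF = from-inner (k , eqF , i<) λ ()
    ... | inj₂ eqG = from-outer (k , eqG , i<) λ ()
    split (is-o-name _) h = from-outer h λ ()
    split (is-i-name _) h = from-inner h λ ()
    split (is-e-name _) h with ∈-++⁻ (edges G) h
    ... | inj₁ e∈ = from-outer e∈ λ ()
    ... | inj₂ e∈ = from-inner e∈ λ ()
    split (prnt (site s) y) h with parent F (site s) in eq
    split (prnt (site s) _) refl | just (node w) = from-inner eq λ ()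
    split (prnt (site s) _) h    | just (root r) = joined (prnt eq h)
    split (prnt (node v) y) h with parent F (node v) in eq
    split (prnt (node v) _) refl | just (node w) = from-inner eq λ ()
    split (prnt (node v) _) h    | just (root r) = joined (prnt eq h)
    split (prnt (node v) _) h    | nothing       = from-outer h λ ()
    split (link (inner i) y) h with linkTo F (inner i) in eq
    split (link (inner i) _) refl | just (edge e)  = from-inner eq λ ()
    split (link (inner i) _) h    | just (outer o) = joined (link eq h)
    split (link (port p) y) h with linkTo F (port p) in eq
    split (link (port p) _) refl | just (edge e)  = from-inner eq λ ()
    split (link (port p) _) h    | just (outer o) = joined (link eq h)
    split (link (port p) _) h    | nothing        = from-outer h λ ()
    split (lc v _) h with <∣>-split (ctrl F v) h
    ... | inj₁ eq = from-inner eq λ ()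
    ... | inj₂ eq = from-outer eq λ ()
    split (lp (v , _) _) ((k , eq , i<) , refl) with <∣>-split (ctrl F v) eq
    ... | inj₁ eqF = from-inner ((k , eqF , i<) , refl) λ ()
    ... | inj₂ eqG = from-outer ((k , eqG , i<) , refl) λ ()

  compose⁺ : IsBigraph G → IsBigraph F → Disjoint (nodes G) (nodes F) →
    ∀ f → Composed G F f → Holds (G ⊙ F) f
  compose⁺ {G = G} {F = F} g b disjoint = glue
    where
    open NodesDisjoint g b disjoint

    glue : ∀ f → Composed G F f → Holds (G ⊙ F) f
    glue (is-root _)   (from-outer h _) = h
    glue (is-root _)   (from-inner h out) = ⊥-elim (out is-root)
    glue (is-node _)   (from-outer h _) = ∈-++⁺ˡ h
    glue (is-node _)   (from-inner h _) = ∈-++⁺ʳ (nodes G) h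
    glue (is-site _)   (from-outer h inn) = ⊥-elim (inn is-site)
    glue (is-site _)   (from-inner h _) = h
    glue (is-port _)   (from-outer (k , eq , i<) _) = k , <∣>-right (ctrl-absent eq) eq , i<
    glue (is-port _)   (from-inner (k , eq , i<) _) = k , <∣>-left eq , i<
    glue (is-o-name _) (from-outer h _) = h
    glue (is-o-name _) (from-inner h out) = ⊥-elim (out is-o-name)
    glue (is-i-name _) (from-outer h inn) = ⊥-elim (inn is-i-name)
    glue (is-i-name _) (from-inner h _) = h
    glue (is-e-name _) (from-outer h _) = ∈-++⁺ˡ h
    glue (is-e-name _) (from-inner h _) = ∈-++⁺ʳ (edges G) h
    glue (prnt (site _) _) (from-outer h inn) = ⊥-elim (inn prnt)
    glue (prnt (node v) _) (from-outer h _) rewrite parent-absent h = h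
    glue (prnt _ (root _)) (from-inner h out) = ⊥-elim (out prnt)
    glue (prnt (site _) (node _)) (from-inner h _) rewrite h = refl
    glue (prnt (node _) (node _)) (from-inner h _) rewrite h = refl
    glue (prnt (site _) _) (joined (prnt eq h)) rewrite eq = h
    glue (prnt (node _) _) (joined (prnt eq h)) rewrite eq = h
    glue (link (inner _) _) (from-outer h inn) = ⊥-elim (inn link)
    glue (link (port _) _)  (from-outer h _) rewrite linkTo-absent h = h
    glue (link _ (outer _)) (from-inner h out) = ⊥-elim (out link)
    glue (link (inner _) (edge _)) (from-inner h _) rewrite h = refl
    glue (link (port _) (edge _))  (from-inner h _) rewrite h = refl
    glue (link (inner _) _) (joined (link eq h)) rewrite eq = h
    glue (link (port _) _)  (joined (link eq h)) rewrite eq = h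
    glue (lc _ _) (from-outer h _) = <∣>-right (ctrl-absent h) h
    glue (lc _ _) (from-inner h _) = <∣>-left h
    glue (lp _ _) (from-outer ((k , eq , i<) , refl) _) =
      (k , <∣>-right (ctrl-absent eq) eq , i<) , refl
    glue (lp _ _) (from-inner ((k , eq , i<) , refl) _) = (k , <∣>-left eq , i<) , refl

  compose-isBigraph : IsBigraph G → IsBigraph F → Composable G F → IsBigraph (G ⊙ F)
  compose-isBigraph {G = G} {F = F} g b comp = record
    { innerNames-unique = F.innerNames-unique
    ; outerNames-unique = G.outerNames-unique
    ; nodes-unique      = Unique.++⁺ G.nodes-unique F.nodes-unique nodes-disjoint
    ; edges-unique      = Unique.++⁺ G.edges-unique F.edges-unique edges-disjoint
    ; ctrl-domain       = λ v → mk⇔ (ctrl-total v) (λ (k , eq) → ctrl-defined eq)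
    ; parent-domain     = λ x → mk⇔ (parent-total x) (λ (y , eq) → parent-defined x eq)
    ; parent-codomain   = λ {x} {y} → parent-codomain x y
    ; parent-acyclic    = acyclic-union {P = _∈ nodes F} {Q = _∈ nodes G}
        (λ v∈F v∈G → nodes-disjoint (v∈G , v∈F)) child-step F.parent-acyclic G.parent-acyclic
    ; linkTo-domain     = λ x → mk⇔ (linkTo-total x) (λ (y , eq) → linkTo-defined x eq)
    ; linkTo-codomain   = λ {x} {y} → linkTo-codomain x y
    }
    where
    module G = IsBigraph g
    module F = IsBigraph b
    open Composable comp

    glue : ∀ f → Composed G F f → Holds (G ⊙ F) f
    glue = compose⁺ g b nodes-disjoint

    node-site : ∀ {j} → j < roots F → ∃[ y ] parent G (site j) ≡ just y
    node-site {j} j< = to (G.parent-domain (site j)) (subst (j <_) (proj₁ interface) j<)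

    link-inner : ∀ {o} → o ∈ outerNames F → ∃[ y ] linkTo G (inner o) ≡ just y
    link-inner {o} o∈ = to (G.linkTo-domain (inner o)) (to (proj₂ interface) o∈)

    ctrl-total : ∀ v → v ∈ nodes G ++ nodes F → ∃[ k ] ctrl (G ⊙ F) v ≡ just k
    ctrl-total v v∈ with ∈-++⁻ (nodes G) v∈
    ... | inj₁ v∈G = let k , eq = to (G.ctrl-domain v) v∈G in k , glue (lc v k) (from-outer eq λ ())
    ... | inj₂ v∈F = let k , eq = to (F.ctrl-domain v) v∈F in k , <∣>-left eq

    ctrl-defined : ∀ {v k} → ctrl (G ⊙ F) v ≡ just k → v ∈ nodes G ++ nodes F
    ctrl-defined {v} {k} eq with compose⁻ {G = G} {F = F} (lc v k) eq
    ... | from-outer h _ = ∈-++⁺ˡ (from (G.ctrl-domain v) (k , h))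
    ... | from-inner h _ = ∈-++⁺ʳ (nodes G) (from (F.ctrl-domain v) (k , h))

    parent-from-inner : ∀ x → IsPlaceSrc F x → ∃[ y ] parent (G ⊙ F) x ≡ just y
    parent-from-inner x h with to (F.parent-domain x) h
    ... | node w , eq = node w , glue (prnt x (node w)) (from-inner eq λ ())
    ... | root r , eq = let y , eq′ = node-site (F.parent-codomain eq) in
      y , glue (prnt x y) (joined (prnt eq eq′))

    parent-total : ∀ x → IsPlaceSrc (G ⊙ F) x → ∃[ y ] parent (G ⊙ F) x ≡ just y
    parent-total (site s) h = parent-from-inner (site s) h
    parent-total (node v) h with ∈-++⁻ (nodes G) h
    ... | inj₂ v∈F = parent-from-inner (node v) v∈F
    ... | inj₁ v∈G = let y , eq = to (G.parent-domain (node v)) v∈G in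
      y , glue (prnt (node v) y) (from-outer eq λ ())

    inner-placeSrc : ∀ x → IsPlaceSrc F x → IsPlaceSrc (G ⊙ F) x
    inner-placeSrc (node _) h = ∈-++⁺ʳ (nodes G) h
    inner-placeSrc (site _) h = h

    parent-defined : ∀ x {y} → parent (G ⊙ F) x ≡ just y → IsPlaceSrc (G ⊙ F) x
    parent-defined x {y} eq with compose⁻ {G = G} {F = F} (prnt x y) eq
    ... | from-inner h _        = inner-placeSrc x (from (F.parent-domain x) (y , h))
    ... | joined (prnt h _)     = inner-placeSrc x (from (F.parent-domain x) (_ , h))
    parent-defined (node v) {y} eq | from-outer h _ =
      ∈-++⁺ˡ (from (G.parent-domain (node v)) (y , h))
    parent-defined (site s) eq | from-outer _ inn = ⊥-elim (inn prnt)

    outer-placeDst : ∀ y → IsPlaceDst G y → IsPlaceDst (G ⊙ F) y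
    outer-placeDst (node _) h = ∈-++⁺ˡ h
    outer-placeDst (root _) h = h

    parent-codomain : ∀ x y → parent (G ⊙ F) x ≡ just y → IsPlaceDst (G ⊙ F) y
    parent-codomain x y eq with compose⁻ {G = G} {F = F} (prnt x y) eq
    ... | from-outer h _    = outer-placeDst y (G.parent-codomain h)
    ... | joined (prnt _ h) = outer-placeDst y (G.parent-codomain h)
    parent-codomain x (node w) eq | from-inner h _   = ∈-++⁺ʳ (nodes G) (F.parent-codomain h)
    parent-codomain x (root r) eq | from-inner _ out = ⊥-elim (out prnt)

    child-step : ∀ {v w} → ChildOf (G ⊙ F) v w →
      (ChildOf F v w × v ∈ nodes F × w ∈ nodes F) ⊎ (ChildOf G v w × v ∈ nodes G × w ∈ nodes G)
      ⊎ (v ∈ nodes F × w ∈ nodes G)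
    child-step {v} {w} eq with compose⁻ {G = G} {F = F} (prnt (node v) (node w)) eq
    ... | from-inner h _     =
      inj₁ (h , from (F.parent-domain (node v)) (_ , h) , F.parent-codomain h)
    ... | from-outer h _     =
      inj₂ (inj₁ (h , from (G.parent-domain (node v)) (_ , h) , G.parent-codomain h))
    ... | joined (prnt h h′) =
      inj₂ (inj₂ (from (F.parent-domain (node v)) (_ , h) , G.parent-codomain h′))

    linkTo-from-inner : ∀ x → IsLinkSrc F x → ∃[ y ] linkTo (G ⊙ F) x ≡ just y
    linkTo-from-inner x h with to (F.linkTo-domain x) h
    ... | edge e , eq  = edge e , glue (link x (edge e)) (from-inner eq λ ())
    ... | outer o , eq = let y , eq′ = link-inner (F.linkTo-codomain eq) in
      y , glue (link x y) (joined (link eq eq′))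

    linkTo-total : ∀ x → IsLinkSrc (G ⊙ F) x → ∃[ y ] linkTo (G ⊙ F) x ≡ just y
    linkTo-total (inner i) h = linkTo-from-inner (inner i) h
    linkTo-total (port p) h with compose⁻ {G = G} {F = F} (is-port p) h
    ... | from-inner h′ _ = linkTo-from-inner (port p) h′
    ... | from-outer h′ _ = let y , eq = to (G.linkTo-domain (port p)) h′ in
      y , glue (link (port p) y) (from-outer eq λ ())

    inner-linkSrc : ∀ x → IsLinkSrc F x → IsLinkSrc (G ⊙ F) x
    inner-linkSrc (inner _) h = h
    inner-linkSrc (port p) h  = glue (is-port p) (from-inner h λ ())

    linkTo-defined : ∀ x {y} → linkTo (G ⊙ F) x ≡ just y → IsLinkSrc (G ⊙ F) x
    linkTo-defined x {y} eq with compose⁻ {G = G} {F = F} (link x y) eq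
    ... | from-inner h _    = inner-linkSrc x (from (F.linkTo-domain x) (y , h))
    ... | joined (link h _) = inner-linkSrc x (from (F.linkTo-domain x) (_ , h))
    linkTo-defined (port p) {y} eq | from-outer h _ =
      glue (is-port p) (from-outer (from (G.linkTo-domain (port p)) (y , h)) λ ())
    linkTo-defined (inner i) eq | from-outer _ inn = ⊥-elim (inn link)

    outer-linkDst : ∀ y → IsLinkDst G y → IsLinkDst (G ⊙ F) y
    outer-linkDst (outer _) h = h
    outer-linkDst (edge _) h  = ∈-++⁺ˡ h

    linkTo-codomain : ∀ x y → linkTo (G ⊙ F) x ≡ just y → IsLinkDst (G ⊙ F) y
    linkTo-codomain x y eq with compose⁻ {G = G} {F = F} (link x y) eq
    ... | from-outer h _    = outer-linkDst y (G.linkTo-codomain h)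
    ... | joined (link _ h) = outer-linkDst y (G.linkTo-codomain h)
    linkTo-codomain x (edge e) eq  | from-inner h _   = ∈-++⁺ʳ (edges G) (F.linkTo-codomain h)
    linkTo-codomain x (outer o) eq | from-inner _ out = ⊥-elim (out link)

  -- Juxtaposition

  juxtapose-isBigraph : IsBigraph G → IsBigraph F → Parallel G F → IsBigraph (G ⊗ F)
  juxtapose-isBigraph {G = G} {F = F} g b par = record
    { innerNames-unique = Unique.++⁺ F.innerNames-unique G.innerNames-unique
        (λ (i∈F , i∈G) → innerNames-disjoint (i∈G , i∈F))
    ; outerNames-unique = deduplicate-! _≟_ (outerNames F ++ outerNames G)
    ; nodes-unique      = Unique.++⁺ F.nodes-unique G.nodes-unique
        (λ (v∈F , v∈G) → nodes-disjoint (v∈G , v∈F))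
    ; edges-unique      = deduplicate-! _≟_ (edges F ++ edges G)
    ; ctrl-domain       = λ v → mk⇔ ctrl-total (λ (k , eq) → ctrl-defined eq)
    ; parent-domain     = λ x → mk⇔ (parent-total x) (λ (y , eq) → parent-defined x eq)
    ; parent-codomain   = λ {x} → parent-codomain x
    ; parent-acyclic    = acyclic-union {P = _∈ nodes F} {Q = _∈ nodes G}
        (λ v∈F v∈G → nodes-disjoint (v∈G , v∈F)) child-step F.parent-acyclic G.parent-acyclic
    ; linkTo-domain     = λ x → mk⇔ (linkTo-total x) (λ (y , eq) → linkTo-defined x eq)
    ; linkTo-codomain   = linkTo-codomain
    }
    where
    module G = IsBigraph g
    module F = IsBigraph b
    open Parallel par

    shift : PlaceDst → PlaceDst
    shift = shiftRoot (roots F)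

    ctrl-total : ∀ {v} → v ∈ nodes F ++ nodes G → ∃[ k ] ctrl (G ⊗ F) v ≡ just k
    ctrl-total {v} v∈ with ctrl F v in eqF | ∈-++⁻ (nodes F) v∈
    ... | just k  | _        = k , refl
    ... | nothing | inj₂ v∈G = to (G.ctrl-domain v) v∈G
    ... | nothing | inj₁ v∈F with _ , eq ← to (F.ctrl-domain v) v∈F =
      case trans (sym eqF) eq of λ ()

    ctrl-defined : ∀ {v k} → ctrl (G ⊗ F) v ≡ just k → v ∈ nodes F ++ nodes G
    ctrl-defined {v} eq with <∣>-split (ctrl F v) eq
    ... | inj₁ eqF = ∈-++⁺ˡ (from (F.ctrl-domain v) (_ , eqF))
    ... | inj₂ eqG = ∈-++⁺ʳ (nodes F) (from (G.ctrl-domain v) (_ , eqG))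

    parent-total : ∀ x → IsPlaceSrc (G ⊗ F) x → ∃[ y ] parent (G ⊗ F) x ≡ just y
    parent-total (node v) v∈ with parent F (node v) in eqF | ∈-++⁻ (nodes F) v∈
    ... | just y  | _        = y , refl
    ... | nothing | inj₂ v∈G = let y , eq = to (G.parent-domain (node v)) v∈G in
      shift y , cong (Maybe.map shift) eq
    ... | nothing | inj₁ v∈F with _ , eq ← to (F.parent-domain (node v)) v∈F =
      case trans (sym eqF) eq of λ ()
    parent-total (site s) s< with s <? sites F
    ... | yes s<F = to (F.parent-domain (site s)) s<F
    ... | no  s≮F =
      let y , eq = to (G.parent-domain (site (s ∸ sites F))) (+-cancelˡ-< (sites F) _ _
                     (subst (_< sites F + sites G) (sym (m+[n∸m]≡n (≮⇒≥ s≮F))) s<))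
      in shift y , cong (Maybe.map shift) eq

    parent-defined : ∀ x {y} → parent (G ⊗ F) x ≡ just y → IsPlaceSrc (G ⊗ F) x
    parent-defined (node v) eq with <∣>-split (parent F (node v)) eq
    ... | inj₁ eqF = ∈-++⁺ˡ (from (F.parent-domain (node v)) (_ , eqF))
    ... | inj₂ eqG = let y , eq′ , _ = map-just⁻ {g = shiftRoot (roots F)} eqG in
      ∈-++⁺ʳ (nodes F) (from (G.parent-domain (node v)) (y , eq′))
    parent-defined (site s) eq with s <? sites F
    ... | yes s<F = <-≤-trans s<F (m≤m+n (sites F) (sites G))
    ... | no  s≮F = let y , eq′ , _ = map-just⁻ {g = shiftRoot (roots F)} eq in
      subst (_< sites F + sites G) (m+[n∸m]≡n (≮⇒≥ s≮F))
        (+-monoʳ-< (sites F) (from (G.parent-domain (site (s ∸ sites F))) (y , eq′)))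

    F-dst : ∀ y → IsPlaceDst F y → IsPlaceDst (G ⊗ F) y
    F-dst (node _) h = ∈-++⁺ˡ h
    F-dst (root _) h = <-≤-trans h (m≤m+n (roots F) (roots G))

    G-dst : ∀ y → IsPlaceDst G y → IsPlaceDst (G ⊗ F) (shift y)
    G-dst (node _) h = ∈-++⁺ʳ (nodes F) h
    G-dst (root _) h = +-monoʳ-< (roots F) h

    shifted-dst : ∀ {m y} → Maybe.map shift m ≡ just y → (∀ {z} → m ≡ just z → IsPlaceDst G z) →
      IsPlaceDst (G ⊗ F) y
    shifted-dst eq cod with z , eq′ , refl ← map-just⁻ {g = shiftRoot (roots F)} eq =
      G-dst z (cod eq′)

    parent-codomain : ∀ x {y} → parent (G ⊗ F) x ≡ just y → IsPlaceDst (G ⊗ F) y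
    parent-codomain (node v) eq with <∣>-split (parent F (node v)) eq
    ... | inj₁ eqF = F-dst _ (F.parent-codomain eqF)
    ... | inj₂ eqG = shifted-dst eqG G.parent-codomain
    parent-codomain (site s) eq with s <? sites F
    ... | yes _ = F-dst _ (F.parent-codomain eq)
    ... | no  _ = shifted-dst eq G.parent-codomain

    child-step : ∀ {v w} → ChildOf (G ⊗ F) v w →
      (ChildOf F v w × v ∈ nodes F × w ∈ nodes F) ⊎ (ChildOf G v w × v ∈ nodes G × w ∈ nodes G)
      ⊎ (v ∈ nodes F × w ∈ nodes G)
    child-step {v} eq with <∣>-split (parent F (node v)) eq
    ... | inj₁ eqF = inj₁ (eqF , from (F.parent-domain (node v)) (_ , eqF) , F.parent-codomain eqF)
    ... | inj₂ eqG with node _ , eq′ , refl ← map-just⁻ {g = shiftRoot (roots F)} eqG =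
      inj₂ (inj₁ (eq′ , from (G.parent-domain (node v)) (_ , eq′) , G.parent-codomain eq′))

    port-split : ∀ p → IsPort (G ⊗ F) p → IsPort F p ⊎ IsPort G p
    port-split (v , _) (k , eq , i<) with <∣>-split (ctrl F v) eq
    ... | inj₁ eqF = inj₁ (k , eqF , i<)
    ... | inj₂ eqG = inj₂ (k , eqG , i<)

    src-split : ∀ x → IsLinkSrc (G ⊗ F) x → IsLinkSrc F x ⊎ IsLinkSrc G x
    src-split (inner _) h = ∈-++⁻ (innerNames F) h
    src-split (port p) h  = port-split p h

    linkTo-total : ∀ x → IsLinkSrc (G ⊗ F) x → ∃[ y ] linkTo (G ⊗ F) x ≡ just y
    linkTo-total x h with linkTo F x in eqF | src-split x h
    ... | just y  | _      = y , refl
    ... | nothing | inj₂ h = to (G.linkTo-domain x) h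
    ... | nothing | inj₁ h with _ , eq ← to (F.linkTo-domain x) h = case trans (sym eqF) eq of λ ()

    src-F : ∀ x → IsLinkSrc F x → IsLinkSrc (G ⊗ F) x
    src-F (inner _) h            = ∈-++⁺ˡ h
    src-F (port _) (k , eq , i<) = k , <∣>-left eq , i<

    src-G : ∀ x → IsLinkSrc G x → IsLinkSrc (G ⊗ F) x
    src-G (inner _) h            = ∈-++⁺ʳ (innerNames F) h
    src-G (port (v , _)) (k , eq , i<) =
      k , <∣>-right (NodesDisjoint.ctrl-absent g b nodes-disjoint eq) eq , i<

    linkTo-defined : ∀ x {y} → linkTo (G ⊗ F) x ≡ just y → IsLinkSrc (G ⊗ F) x
    linkTo-defined x eq with <∣>-split (linkTo F x) eq
    ... | inj₁ eqF = src-F x (from (F.linkTo-domain x) (_ , eqF))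
    ... | inj₂ eqG = src-G x (from (G.linkTo-domain x) (_ , eqG))

    dst-F : ∀ y → IsLinkDst F y → IsLinkDst (G ⊗ F) y
    dst-F (outer _) h = ∈-deduplicate⁺ _≟_ (∈-++⁺ˡ h)
    dst-F (edge _)  h = ∈-deduplicate⁺ _≟_ (∈-++⁺ˡ h)

    dst-G : ∀ y → IsLinkDst G y → IsLinkDst (G ⊗ F) y
    dst-G (outer _) h = ∈-deduplicate⁺ _≟_ (∈-++⁺ʳ (outerNames F) h)
    dst-G (edge _)  h = ∈-deduplicate⁺ _≟_ (∈-++⁺ʳ (edges F) h)

    linkTo-codomain : ∀ {x y} → linkTo (G ⊗ F) x ≡ just y → IsLinkDst (G ⊗ F) y
    linkTo-codomain {x} {y} eq with <∣>-split (linkTo F x) eq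
    ... | inj₁ eqF = dst-F y (F.linkTo-codomain eqF)
    ... | inj₂ eqG = dst-G y (G.linkTo-codomain eqG)

  -- A fact on neither face is not affected by the shift of sites and roots.
  juxtapose⁻ : ∀ f → ¬ OnOuterface f → ¬ OnInnerface f → Holds (G ⊗ F) f → Holds G f ⊎ Holds F f
  juxtapose⁻ {G = G} {F = F} = split
    where
    split-port : ∀ p → IsPort (G ⊗ F) p → IsPort G p ⊎ IsPort F p
    split-port (v , _) (k , eq , i<) with <∣>-split (ctrl F v) eq
    ... | inj₁ eqF = inj₂ (k , eqF , i<)
    ... | inj₂ eqG = inj₁ (k , eqG , i<)

    split : ∀ f → ¬ OnOuterface f → ¬ OnInnerface f → Holds (G ⊗ F) f → Holds G f ⊎ Holds F f
    split (is-root _) out inn h   = ⊥-elim (out is-root)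
    split (is-node _) out inn h   = swap (∈-++⁻ (nodes F) h)
    split (is-site _) out inn h   = ⊥-elim (inn is-site)
    split (is-port p) out inn h   = split-port p h
    split (is-o-name _) out inn h = ⊥-elim (out is-o-name)
    split (is-i-name _) out inn h = ⊥-elim (inn is-i-name)
    split (is-e-name _) out inn h = swap (∈-++⁻ (edges F) (∈-deduplicate⁻ _≟_ _ h))
    split (prnt _ (root _)) out inn h = ⊥-elim (out prnt)
    split (prnt (site _) _) out inn h = ⊥-elim (inn prnt)
    split (prnt (node v) (node w)) out inn h with <∣>-split (parent F (node v)) h
    ... | inj₁ eqF = inj₂ eqF
    ... | inj₂ eqG with node _ , eq , refl ← map-just⁻ {g = shiftRoot (roots F)} eqG = inj₁ eq
    split (link x _) out inn h = swap (<∣>-split (linkTo F x) h)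
    split (lc v _) out inn h   = swap (<∣>-split (ctrl F v) h)
    split (lp p _) out inn (h , refl) with split-port p h
    ... | inj₁ hG = inj₁ (hG , refl)
    ... | inj₂ hF = inj₂ (hF , refl)

  juxtapose⁺ : IsBigraph G → IsBigraph F → Parallel G F →
    ∀ f → ¬ OnOuterface f → ¬ OnInnerface f → Holds G f ⊎ Holds F f → Holds (G ⊗ F) f
  juxtapose⁺ {G = G} {F = F} g b par = merge
    where
    open NodesDisjoint g b (Parallel.nodes-disjoint par)

    merge : ∀ f → ¬ OnOuterface f → ¬ OnInnerface f → Holds G f ⊎ Holds F f → Holds (G ⊗ F) f
    merge (is-root _) out inn h            = ⊥-elim (out is-root)
    merge (is-site _) out inn h            = ⊥-elim (inn is-site)
    merge (is-o-name _) out inn h          = ⊥-elim (out is-o-name)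
    merge (is-i-name _) out inn h          = ⊥-elim (inn is-i-name)
    merge (is-node _) out inn (inj₁ h)     = ∈-++⁺ʳ (nodes F) h
    merge (is-node _) out inn (inj₂ h)     = ∈-++⁺ˡ h
    merge (is-e-name _) out inn (inj₁ h)   = ∈-deduplicate⁺ _≟_ (∈-++⁺ʳ (edges F) h)
    merge (is-e-name _) out inn (inj₂ h)   = ∈-deduplicate⁺ _≟_ (∈-++⁺ˡ h)
    merge (is-port _) out inn (inj₁ (k , eq , i<)) = k , <∣>-right (ctrl-absent eq) eq , i<
    merge (is-port _) out inn (inj₂ (k , eq , i<)) = k , <∣>-left eq , i<
    merge (prnt _ (root _)) out inn h      = ⊥-elim (out prnt)
    merge (prnt (site _) _) out inn h      = ⊥-elim (inn prnt)
    merge (prnt (node _) (node _)) out inn (inj₁ h) =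
      <∣>-right (parent-absent h) (cong (Maybe.map _) h)
    merge (prnt (node _) (node _)) out inn (inj₂ h) = <∣>-left h
    merge (link _ (outer _)) out inn h     = ⊥-elim (out link)
    merge (link (inner _) _) out inn h     = ⊥-elim (inn link)
    merge (link (port _) _) out inn (inj₁ h) = <∣>-right (linkTo-absent h) h
    merge (link (port _) _) out inn (inj₂ h) = <∣>-left h
    merge (lc _ _) out inn (inj₁ h)        = <∣>-right (ctrl-absent h) h
    merge (lc _ _) out inn (inj₂ h)        = <∣>-left h
    merge (lp _ _) out inn (inj₁ ((k , eq , i<) , refl)) =
      (k , <∣>-right (ctrl-absent eq) eq , i<) , refl
    merge (lp _ _) out inn (inj₂ ((k , eq , i<) , refl)) = (k , <∣>-left eq , i<) , refl
    merge (has-child-p _ _) _ _ (inj₁ ())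
    merge (has-child-p _ _) _ _ (inj₂ ())
    merge (has-child-l _ _) _ _ (inj₁ ())
    merge (has-child-l _ _) _ _ (inj₂ ())
    merge (vp _ _) _ _ (inj₁ ())
    merge (vp _ _) _ _ (inj₂ ())

  -- If G has no sites, every site of G ⊗ F is one of F, and the sites and roots of F
  -- are not shifted.
  site-parent-right : IsBigraph G → sites G ≡ 0 → ∀ {s y} →
    parent (G ⊗ F) (site s) ≡ just y → parent F (site s) ≡ just y
  site-parent-right {G = G} {F = F} g no-sites {s} eq with s <? sites F
  ... | yes _ = eq
  ... | no  _ with z , eq′ , _ ← map-just⁻ {g = shiftRoot (roots F)} eq =
    case subst (_ <_) no-sites (from (IsBigraph.parent-domain g _) (z , eq′)) of λ ()

  -- The sets core and eq

  core⁺ : IsBigraph K → Holds K f → ¬ OnOuterface f → ¬ OnInnerface f → core K f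
  core⁺ {f = f} k h out inn = ⟦⟧⁺ k f h , (λ (_ , o) → out o) , (λ (_ , i , _) → inn i)

  core⁻ : ∀ K → core K f → (Structural f → Holds K f) × ¬ OnOuterface f × ¬ OnInnerface f
  core⁻ K (f∈ , not-out , not-in) =
    ⟦⟧⁻ {B = K} f∈ , (λ o → not-out (f∈ , o)) , (λ i → not-in (f∈ , i , λ o → not-out (f∈ , o)))

  eq⇒joined : eq G F f → Joined G F f
  eq⇒joined {G = G} {F = F} (prnt _ _ refl x∈ y∈) =
    prnt (⟦⟧⁻ {B = F} x∈ (attribute (here refl))) (⟦⟧⁻ {B = G} y∈ (attribute (here refl)))
  eq⇒joined {G = G} {F = F} (link _ _ refl y∈ x∈) =
    link (⟦⟧⁻ {B = F} x∈ (attribute (here refl))) (⟦⟧⁻ {B = G} y∈ (attribute (here refl)))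

  joined⇒eq : IsBigraph G → IsBigraph F → Joined G F f → eq G F f
  joined⇒eq g b (prnt h h′) = prnt
    (⟦⟧⁺ b (is-root _) (IsBigraph.parent-codomain b h))
    (⟦⟧⁺ g (is-site _) (from (IsBigraph.parent-domain g (site _)) (_ , h′)))
    refl (⟦⟧⁺ b (prnt _ _) h) (⟦⟧⁺ g (prnt _ _) h′)
  joined⇒eq g b (link h h′) = link
    (⟦⟧⁺ g (is-i-name _) (from (IsBigraph.linkTo-domain g (inner _)) (_ , h′)))
    (⟦⟧⁺ b (is-o-name _) (IsBigraph.linkTo-codomain b h))
    refl (⟦⟧⁺ g (link _ _) h′) (⟦⟧⁺ b (link _ _) h)

  joined-not-component : Joined G F f → ¬ Component f
  joined-not-component (prnt _ _) ()
  joined-not-component (link _ _) ()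

  -- The source of a joint leads, in F, to the outer face; so a joint that is also a
  -- fact of F is on the outer face.
  joined-outerface : Joined G F f → Holds F f → OnOuterface f
  joined-outerface (prnt h _) h′ with refl ← trans (sym h) h′ = prnt
  joined-outerface (link h _) h′ with refl ← trans (sym h) h′ = link

  port-node : IsBigraph B → ∀ {p} → IsPort B p → proj₁ p ∈ nodes B
  port-node b (k , eq , _) = from (IsBigraph.ctrl-domain b _) (k , eq)

  -- The source of a joint belongs to F, hence not to a bigraph C disjoint from F.
  joined-foreign : IsBigraph C → IsBigraph F → Disjoint (nodes C) (nodes F) →
    Joined G F f → Holds C f → ¬ ¬ OnInnerface f
  joined-foreign c b disjoint (prnt {x = site _} _ _) hC inn = inn prnt
  joined-foreign c b disjoint (prnt {x = node v} h _) hC inn = disjoint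
    (from (IsBigraph.parent-domain c (node v)) (_ , hC) ,
     from (IsBigraph.parent-domain b (node v)) (_ , h))
  joined-foreign c b disjoint (link {x = inner _} _ _) hC inn = inn link
  joined-foreign c b disjoint (link {x = port p} h _) hC inn = disjoint
    (port-node c (from (IsBigraph.linkTo-domain c (port p)) (_ , hC)) ,
     port-node b (from (IsBigraph.linkTo-domain b (port p)) (_ , h)))

  holds-foreign : IsBigraph C → IsBigraph F → Disjoint (nodes C) (nodes F) →
    Disjoint (edges C) (edges F) →
    ∀ f → Holds C f → ¬ OnInnerface f → Holds F f → ¬ ¬ OnOuterface f
  holds-foreign {C = C} {F = F} c b nodes-disjoint edges-disjoint = clash
    where
    clash : ∀ f → Holds C f → ¬ OnInnerface f → Holds F f → ¬ ¬ OnOuterface f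
    clash (is-root _) hC inn hF out   = out is-root
    clash (is-node _) hC inn hF out   = nodes-disjoint (hC , hF)
    clash (is-site _) hC inn hF out   = inn is-site
    clash (is-port _) hC inn hF out   = nodes-disjoint (port-node c hC , port-node b hF)
    clash (is-o-name _) hC inn hF out = out is-o-name
    clash (is-i-name _) hC inn hF out = inn is-i-name
    clash (is-e-name _) hC inn hF out = edges-disjoint (hC , hF)
    clash (prnt (site _) _) hC inn hF out = inn prnt
    clash (prnt (node v) _) hC inn hF out = nodes-disjoint
      (from (IsBigraph.parent-domain c (node v)) (_ , hC) ,
       from (IsBigraph.parent-domain b (node v)) (_ , hF))
    clash (link (inner _) _) hC inn hF out = inn link
    clash (link (port p) _) hC inn hF out = nodes-disjoint
      (port-node c (from (IsBigraph.linkTo-domain c (port p)) (_ , hC)) ,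
       port-node b (from (IsBigraph.linkTo-domain b (port p)) (_ , hF)))
    clash (lc v _) hC inn hF out = nodes-disjoint
      (from (IsBigraph.ctrl-domain c v) (_ , hC) , from (IsBigraph.ctrl-domain b v) (_ , hF))
    clash (lp _ _) (hC , _) inn (hF , _) out = nodes-disjoint (port-node c hC , port-node b hF)

  -- Replacing the inner part of a composite

  -- P is a set of facts to be exchanged when M is replaced inside C ⊙ M.  The facts
  -- in I are those of M that P leaves out and that must stay the same.  P covers the
  -- joints of C with M and all other facts of M off its outer face, and contains no
  -- fact of C off its inner face.  Only the components in P are required to be facts
  -- of M: P may contain attributes that do not hold of C ⊙ M.
  record Side (C M : PreBigraph) (I P : FactSet) : Set where
    field
      C-isBigraph : IsBigraph C
      M-isBigraph : IsBigraph M
      composable  : Composable C M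
      boundary    : Joined C M f → P f
      interior    : Holds M f → ¬ OnOuterface f → P f ⊎ I f
      components  : Component f → P f → Holds M f × ¬ OnOuterface f
      exterior    : P f → Holds C f → ¬ ¬ OnInnerface f
      kept        : I f → Holds M f × ¬ OnOuterface f × ¬ P f

    composite : IsBigraph (C ⊙ M)
    composite = compose-isBigraph C-isBigraph M-isBigraph composable

    composed⁺ : ∀ f → Composed C M f → Holds (C ⊙ M) f
    composed⁺ = compose⁺ C-isBigraph M-isBigraph (Composable.nodes-disjoint composable)

  -- Rewriting P into P′ turns a multi-set that interprets to C ⊙ M into one that
  -- interprets to C ⊙ M′, provided that both are valid.
  replacement : {B : Bigraph} {I I′ P P′ : FactSet} {M M′ : PreBigraph} →
    (side : Side C M I P) (side′ : Side C M′ I′ P′) → I ≐ I′ →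
    W Lists P → Z Lists P′ → Rewrites W Z X Y → Valid X → Valid Y →
    X ⟦⟧⋆ B → pre B ≡ᴮ C ⊙ M → Y ⟦⟧⋆ (C ⊙ M′ , Side.composite side′)
  replacement {C = C} {W = W} {Z = Z} {X = X} {Y = Y} {B = B} {I} {I′} {P} {P′} {M} {M′}
    side side′ (I⊆I′ , I′⊆I) W-lists Z-lists rewrites X-valid Y-valid X⋆B B≡CM =
    same-facts⇒interpreted complete (attributes-determined (valid-wellFormed Y-valid)
      (holds-total (Side.composite side′)) complete sound)
    where
    module M = Side side
    module M′ = Side side′
    open Rewrites rewrites

    CM⇒X : ∀ f → Holds (C ⊙ M) f → f ∈ X
    CM⇒X f = interpreted⁺ X⋆B f ∘ ≡ᴮ⇒holds⁻ (isBigraph B) M.composite B≡CM f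

    X⇒CM : Structural f → f ∈ X → Holds (C ⊙ M) f
    X⇒CM {f} s = ≡ᴮ⇒holds⁺ (isBigraph B) B≡CM f ∘ interpreted⁻ X⋆B f s

    -- A fact of C ⊙ M that is not in P lies in the part of X that is not rewritten.
    retained : ∀ f → Holds (C ⊙ M) f → ¬ P f → f ∈ Y
    retained f h ¬p with ∈-++⁻ W (∈-resp-↭ S≡W⊎Δ (CM⇒X f h))
    ... | inj₁ f∈W = ⊥-elim (¬p (to (_Lists_.elements W-lists f) f∈W))
    ... | inj₂ f∈Δ = ∈-resp-↭ (↭-sym T≡Z⊎Δ) (∈-++⁺ʳ Z f∈Δ)

    produced : ∀ f → P′ f → f ∈ Y
    produced f p = ∈-resp-↭ (↭-sym T≡Z⊎Δ) (∈-++⁺ˡ (from (_Lists_.elements Z-lists f) p))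

    Y⁻ : f ∈ Y → P′ f ⊎ (f ∈ X × ¬ P f)
    Y⁻ {f} f∈Y with ∈-++⁻ Z (∈-resp-↭ T≡Z⊎Δ f∈Y)
    ... | inj₁ f∈Z = inj₁ (to (_Lists_.elements Z-lists f) f∈Z)
    ... | inj₂ f∈Δ = inj₂ (∈-resp-↭ (↭-sym S≡W⊎Δ) (∈-++⁺ʳ W f∈Δ) , λ p →
      Unique-++⇒Disjoint (Unique-resp-↭ S≡W⊎Δ (Valid.multiplicity-one X-valid))
        (from (_Lists_.elements W-lists f) p , f∈Δ))

    complete : ∀ f → Holds (C ⊙ M′) f → f ∈ Y
    complete f h with compose⁻ {G = C} {F = M′} f h
    ... | from-outer hC inn = retained f (M.composed⁺ f (from-outer hC inn))
      (λ p → M.exterior p hC inn)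
    ... | joined j          = produced f (M′.boundary j)
    ... | from-inner hM′ out with M′.interior hM′ out
    ...   | inj₁ p = produced f p
    ...   | inj₂ i = let hM , out , ¬p = M.kept (I′⊆I i) in
      retained f (M.composed⁺ f (from-inner hM out)) ¬p

    sound : ∀ {f} → Component f → f ∈ Y → Holds (C ⊙ M′) f
    sound {f} c f∈Y with Y⁻ f∈Y
    ... | inj₁ p = let hM′ , out = M′.components c p in M′.composed⁺ f (from-inner hM′ out)
    ... | inj₂ (f∈X , ¬p) with compose⁻ {G = C} {F = M} f (X⇒CM (component c) f∈X)
    ...   | from-outer hC inn = M′.composed⁺ f (from-outer hC inn)
    ...   | joined j          = ⊥-elim (joined-not-component j c)
    ...   | from-inner hM out with M.interior hM out
    ...     | inj₁ p = ⊥-elim (¬p p)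
    ...     | inj₂ i = let hM′ , out , _ = M′.kept (I⊆I′ i) in
      M′.composed⁺ f (from-inner hM′ out)

  -- Ground rules

  ≏-sites : B ≏ G → sites B ≡ sites G
  ≏-sites (_ , _ , e) = proj₁ (LeanEquivalence.same-innerface e)

  ground-variant : IsBigraph B → B ≏ G → Ground G → ∀ f → Holds B f → ¬ OnInnerface f
  ground-variant {B = B} b (_ , _ , e) (no-sites , no-names) = empty-innerface
    where
    open IsBigraph b
    open LeanEquivalence e

    no-site : ∀ {s} → ¬ s < sites B
    no-site s< = case subst (_ <_) (trans (proj₁ same-innerface) no-sites) s< of λ ()

    no-inner : ∀ {i} → i ∉ innerNames B
    no-inner i∈ = case to no-names (to (proj₂ same-innerface) i∈) of λ ()

    empty-innerface : ∀ f → Holds B f → ¬ OnInnerface f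
    empty-innerface _ h is-site   = no-site h
    empty-innerface _ h is-i-name = no-inner h
    empty-innerface _ h (prnt {s}) = no-site (from (parent-domain (site s)) (_ , h))
    empty-innerface _ h (link {i}) = no-inner (from (linkTo-domain (inner i)) (_ , h))

  ground-side : IsBigraph C → IsBigraph K → Composable C K →
    (∀ f → Holds K f → ¬ OnInnerface f) → Side C K ∅ (core K ∪ eq C K)
  ground-side {C = C} {K = K} c k comp closed = record
    { C-isBigraph = c
    ; M-isBigraph = k
    ; composable  = comp
    ; boundary    = λ j → inj₂ (joined⇒eq c k j)
    ; interior    = λ {f} h out → inj₁ (inj₁ (core⁺ k h out (closed f h)))
    ; components  = components
    ; exterior    = exterior
    ; kept        = λ ()
    }
    where
    components : Component f → (core K ∪ eq C K) f → Holds K f × ¬ OnOuterface f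
    components comp (inj₁ cr) = let holds , out , _ = core⁻ K cr in holds (component comp) , out
    components comp (inj₂ j) = ⊥-elim (joined-not-component (eq⇒joined j) comp)

    exterior : (core K ∪ eq C K) f → Holds C f → ¬ ¬ OnInnerface f
    exterior {f} (inj₁ cr) hC inn = let holds , out , _ = core⁻ K cr in
      holds-foreign c k (Composable.nodes-disjoint comp) (Composable.edges-disjoint comp) f hC inn
        (holds (holds⇒structural f hC)) out
    exterior (inj₂ j) hC inn =
      joined-foreign c k (Composable.nodes-disjoint comp) (eq⇒joined j) hC inn

  -- Parametric rules

  -- One side of a parametric rule: K is the redex or the reactum, F the parameters.
  module ParametricSide {C D K F : PreBigraph}
    (c : IsBigraph C) (d : IsBigraph D) (k : IsBigraph K) (b : IsBigraph F)
    (parallel : Parallel D K) (DK-F : Composable (D ⊗ K) F)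
    (C-M : Composable C ((D ⊗ K) ⊙ F)) (no-sites : sites D ≡ 0) where

    M : PreBigraph
    M = (D ⊗ K) ⊙ F

    P : FactSet
    P = eq C M ∪ core K ∪ core D ∪ eq D F ∪ eq K F ∪ core F

    dk : IsBigraph (D ⊗ K)
    dk = juxtapose-isBigraph d k parallel

    m : IsBigraph M
    m = compose-isBigraph dk b DK-F

    composed⁺ : ∀ f → Composed (D ⊗ K) F f → Holds M f
    composed⁺ = compose⁺ dk b (Composable.nodes-disjoint DK-F)

    C-F : Disjoint (nodes C) (nodes F)
    C-F (v∈C , v∈F) = Composable.nodes-disjoint C-M (v∈C , ∈-++⁺ʳ (nodes (D ⊗ K)) v∈F)

    -- Off the outer face, the joints of D ⊗ K with F are those of its parts.  For
    -- prnt this uses that D has no sites, so that every site of D ⊗ K is one of K.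
    joined-part : ∀ {f} → Joined (D ⊗ K) F f → ¬ OnOuterface f → eq D F f ⊎ eq K F f
    joined-part (prnt h h′) out =
      inj₂ (joined⇒eq k b (prnt h (site-parent-right {F = K} d no-sites h′)))
    joined-part (link h h′) out with <∣>-split (linkTo K _) h′
    ... | inj₁ hK = inj₂ (joined⇒eq k b (link h hK))
    ... | inj₂ hD = inj₁ (joined⇒eq d b (link h hD))

    interior : ∀ {f} → Holds M f → ¬ OnOuterface f → P f ⊎ in′ F f
    interior {f} h out with compose⁻ {G = D ⊗ K} {F = F} f h
    ... | from-outer hDK inn with juxtapose⁻ {G = D} {F = K} f out inn hDK
    ...   | inj₁ hD = inj₁ (inj₂ (inj₂ (inj₁ (core⁺ d hD out inn))))
    ...   | inj₂ hK = inj₁ (inj₂ (inj₁ (core⁺ k hK out inn)))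
    interior {f} h out | joined j with joined-part j out
    ...   | inj₁ eD = inj₁ (inj₂ (inj₂ (inj₂ (inj₁ eD))))
    ...   | inj₂ eK = inj₁ (inj₂ (inj₂ (inj₂ (inj₂ (inj₁ eK)))))
    interior {f} h out | from-inner hF _ with onInnerface? f
    ...   | yes inn = inj₂ (⟦⟧⁺ b f hF , inn , out)
    ...   | no ¬inn = inj₁ (inj₂ (inj₂ (inj₂ (inj₂ (inj₂ (core⁺ b hF out ¬inn))))))

    -- Where a member of P comes from.  The facts of the parts include counts, which
    -- do not hold of M, whence the restriction to structural facts.
    data Origin (f : Fact) : Set where
      of-part     : (Structural f → Holds M f) → ¬ OnOuterface f → ¬ OnInnerface f → Origin f
      of-joint    : Joined G F f → Origin f
      of-boundary : Joined C M f → Origin f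

    origin : ∀ {f} → P f → Origin f
    origin (inj₁ e) = of-boundary (eq⇒joined e)
    origin {f} (inj₂ (inj₁ cK)) = let holds , out , inn = core⁻ K cK in
      of-part (λ s → composed⁺ f (from-outer (juxtapose⁺ d k parallel f out inn
        (inj₂ (holds s))) inn)) out inn
    origin {f} (inj₂ (inj₂ (inj₁ cD))) = let holds , out , inn = core⁻ D cD in
      of-part (λ s → composed⁺ f (from-outer (juxtapose⁺ d k parallel f out inn
        (inj₁ (holds s))) inn)) out inn
    origin (inj₂ (inj₂ (inj₂ (inj₁ e)))) = of-joint (eq⇒joined e)
    origin (inj₂ (inj₂ (inj₂ (inj₂ (inj₁ e))))) = of-joint (eq⇒joined e)
    origin {f} (inj₂ (inj₂ (inj₂ (inj₂ (inj₂ cF))))) = let holds , out , inn = core⁻ F cF in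
      of-part (λ s → composed⁺ f (from-inner (holds s) out)) out inn

    components : ∀ {f} → Component f → P f → Holds M f × ¬ OnOuterface f
    components comp p with origin p
    ... | of-part h out _  = h (component comp) , out
    ... | of-joint j       = ⊥-elim (joined-not-component j comp)
    ... | of-boundary j    = ⊥-elim (joined-not-component j comp)

    exterior : ∀ {f} → P f → Holds C f → ¬ ¬ OnInnerface f
    exterior {f} p hC inn with origin p
    ... | of-part h out _ = holds-foreign c m (Composable.nodes-disjoint C-M)
      (Composable.edges-disjoint C-M) f hC inn (h (holds⇒structural f hC)) out
    ... | of-joint j      = joined-foreign c b C-F j hC inn
    ... | of-boundary j   = joined-foreign c m (Composable.nodes-disjoint C-M) j hC inn

    kept : ∀ {f} → in′ F f → Holds M f × ¬ OnOuterface f × ¬ P f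
    kept {f} (f∈ , inn , out) = hM , out , not-P
      where
      hF : Holds F f
      hF = ⟦⟧⁻ {B = F} f∈ (inner⇒structural inn)

      hM : Holds M f
      hM = composed⁺ f (from-inner hF out)

      not-P : ¬ P f
      not-P p with origin p
      ... | of-part _ _ ¬inn = ¬inn inn
      ... | of-joint j       = out (joined-outerface j hF)
      ... | of-boundary j    = out (joined-outerface j hM)

    side : Side C M (in′ F) P
    side = record
      { C-isBigraph = c
      ; M-isBigraph = m
      ; composable  = C-M
      ; boundary    = λ j → inj₁ (joined⇒eq c m j)
      ; interior    = interior
      ; components  = components
      ; exterior    = exterior
      ; kept        = kept
      }

  -- Reactions

  instantiated-roots : ∀ {n n′ F F′} {η : Fin n′ → Fin n} →
    Instantiation η F F′ → roots F ≡ n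
  instantiated-roots inst with _ , _ , e ← Instantiation.decomposition inst =
    trans (proj₁ (LeanEquivalence.same-outerface e))
      (IsLinkGraph.roots≡m (Instantiation.G-linkGraph inst))

  -- The roots of the parameters are the sites of D ⊗ L, and there are as many of them
  -- as L has sites.
  context-no-sites : ∀ {r} (ρ : ParametricReaction r) → sites (pre (ParametricReaction.D ρ)) ≡ 0
  context-no-sites {r} ρ = +-cancelˡ-≡ (sites (pre L₁)) _ 0 (
    trans (sym (proj₁ (Composable.interface DL₁-C′))) (
    trans (instantiated-roots ηC′-inst) (
    trans (sym (proj₁ (ParametricRule.L-innerface r))) (
    trans (sym (≏-sites L₁≏L)) (sym (+-identityʳ (sites (pre L₁))))))))
    where open ParametricReaction ρ

  -- The result of the reaction is a bigraph, and the one that Y encodes.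
  after-interpreted : ∀ {B} r → X ⟦⟧⋆ B → Valid X → Valid Y →
    (rule : ModelledRule r B W Z) → Rewrites W Z X Y →
    Σ[ b ∈ IsBigraph (after r (ModelledRule.reaction rule)) ] Y ⟦⟧⋆ (_ , b)
  after-interpreted (ground r) X⋆B X-valid Y-valid rule rewrites = Side.composite R-side ,
    replacement L-side R-side ((λ ()) , (λ ())) W-lists Z-lists rewrites X-valid Y-valid X⋆B
      decomposition
    where
    open ModelledRule rule
    open GroundRule r using (L-ground; R-ground)
    module ρ = GroundReaction reaction

    L-side = ground-side (isBigraph ρ.C) (isBigraph ρ.L₁) ρ.C-L₁
      (ground-variant (isBigraph ρ.L₁) ρ.L₁≏L L-ground)
    R-side = ground-side (isBigraph ρ.C) (isBigraph ρ.R₁) ρ.C-R₁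
      (ground-variant (isBigraph ρ.R₁) ρ.R₁≏R R-ground)
  after-interpreted (parametric r) X⋆B X-valid Y-valid rule rewrites = Side.composite R-side ,
    replacement L-side R-side same-sites W-lists Z-lists rewrites X-valid Y-valid X⋆B
      decomposition
    where
    open ModelledRule rule
    module ρ = ParametricReaction reaction

    L-side = ParametricSide.side (isBigraph ρ.C) (isBigraph ρ.D) (isBigraph ρ.L₁) (isBigraph ρ.C′)
      (Tensorable.parallel ρ.D-L₁) ρ.DL₁-C′ ρ.C-DL₁C′ (context-no-sites reaction)
    R-side = ParametricSide.side (isBigraph ρ.C) (isBigraph ρ.D) (isBigraph ρ.R₁) (isBigraph ρ.ηC′)
      (Tensorable.parallel ρ.D-R₁) ρ.DR₁-ηC′ ρ.C-DR₁ηC′ (context-no-sites reaction)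

  interpretation-unique : ∀ {A B} → X ⟦⟧⋆ A → X ⟦⟧⋆ B → pre A ≡ᴮ pre B
  interpretation-unique {A = A} X⋆A X⋆B =
    same-facts⇒≡ᴮ (isBigraph A) (transfer X⋆A X⋆B) (transfer X⋆B X⋆A)
    where
    transfer : ∀ {A B} → X ⟦⟧⋆ A → X ⟦⟧⋆ B → ∀ f → Holds (pre A) f → Holds (pre B) f
    transfer X⋆A X⋆B f h = interpreted⁻ X⋆B f (holds⇒structural f h) (interpreted⁺ X⋆A f h)

theorem4 : (𝒮 : Signature) → let open Bigraphs 𝒮 in
    (X Y W Z : Multiset) → Valid X → Valid Y →
    (B : Bigraph) → X ⟦⟧⋆ B →
    (r : ReactionRule) → Applicable r B → ModelledRule r B W Z →
    Rewrites W Z X Y →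
    (∃[ B′ ] Y ⟦⟧⋆ B′) × (∀ B′ → Y ⟦⟧⋆ B′ → B ⟶[ r ] B′)
theorem4 𝒮 X Y W Z X-valid Y-valid B X⋆B r _ rule rewrites =
  let b , Y⋆after = after-interpreted 𝒮 r X⋆B X-valid Y-valid rule rewrites in
  (_ , Y⋆after) , λ B′ Y⋆B′ →
    reaction , (id , id , decomposition) , (id , id , interpretation-unique 𝒮 Y⋆B′ Y⋆after)
  where
  open Bigraphs 𝒮
  open ModelledRule rule
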